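{- Let $p$ be a prime, $m\in\mathbb{N}$ with $m\ge 1$, $n=p^m$, and $S=\{a\in\mathbb{Z}_n \mid \gcd(a,n)=1\}$. Then the Cayley graph $\Gamma=\mathrm{Cay}(\mathbb{Z}_n,S)$ is a DS graph with respect to its adjacency spectrum.
   Context: For a finite group $G$ and an inverse-closed subset $H\subseteq G$ not containing the identity, $\mathrm{Cay}(G,H)$ is the simple undirected graph with vertex set $G$ in which $x,y$ are adjacent iff $x^{ -1}y\in H$. Here $G=\mathbb{Z}_n$ is the additive cyclic group, so $x,y$ are adjacent iff $y-x\in S$. The adjacency spectrum of a finite simple graph is the multiset of eigenvalues of its adjacency matrix. A graph is DS (determined by its spectrum) with respect to its adjacency spectrum if every finite simple graph with the same adjacency spectrum is isomorphic to it. -}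

module Defs where

open import Algebra.Bundles using (CommutativeRing; Group)
open import Algebra.Structures using (IsGroup; IsCommutativeRing)
open import Data.Bool.Base using (if_then_else_)
open import Data.Fin.Base using (Fin; zero; suc; toℕ; punchIn)
import Data.Fin.Properties as Fin
open import Data.List.Base using (List; foldr; map)
open import Data.Nat.Base as ℕ using (ℕ; zero; suc; NonZero; NonTrivial)
import Data.Nat.Coprimality as Coprimality
open import Data.Nat.DivMod using (_mod_; _%_; m%n<n; m<n⇒m%n≡m; n%n≡0; %-distribˡ-+; m%n%n≡m%n)
open import Data.Nat.Divisibility using (_∣_; ∣m+n∣m⇒∣n; ∣n∣m%n⇒∣m)
open import Data.Nat.GCD using (gcd; gcd-identityˡ)
open import Data.Nat.Primality using (Prime; prime⇒nonTrivial; prime⇒nonZero)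
import Data.Nat.Properties as ℕ
open import Data.Product.Base using (Σ; ∃-syntax; _×_; _,_)
open import Data.Rational.Base as ℚ using (ℚ; 0ℚ; 1ℚ; ½; ∣_∣)
import Data.Rational.Properties as ℚ
open import Data.Rational.Solver using (module +-*-Solver)
open import Function.Bundles using (_↔_; _⇔_; Inverse)
open import Function.Construct.Identity using (↔-id)
open import Level using (0ℓ)
open import Relation.Binary.Core using (Rel)
open import Relation.Binary.Definitions using (Symmetric)
open import Relation.Binary.PropositionalEquality using (_≡_; refl; sym; trans; cong; cong₂; subst; isEquivalence; module ≡-Reasoning)
open import Relation.Nullary.Decidable using (Dec; does)
open import Relation.Nullary.Negation using (¬_)

-- Real numbers: Cauchy sequences of rationals, two of them being equal
-- when their difference tends to 0.

Cauchy : (ℕ → ℚ) → Set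
Cauchy x = ∀ ε → 0ℚ ℚ.< ε →
  ∃[ N ] (∀ m n → N ℕ.≤ m → N ℕ.≤ n → ∣ x m ℚ.- x n ∣ ℚ.< ε)

record ℝ : Set where
  constructor mkℝ
  field
    seq    : ℕ → ℚ
    cauchy : Cauchy seq

open ℝ public

infix 4 _≈_
record _≈_ (x y : ℝ) : Set where
  constructor mk≈
  field
    diff→0 : ∀ ε → 0ℚ ℚ.< ε → ∃[ N ] (∀ n → N ℕ.≤ n → ∣ seq x n ℚ.- seq y n ∣ ℚ.< ε)

open _≈_ public

-- Families of rationals over an index type I that tend to 0 along the
-- tails T N; used with I = ℕ for _≈_ and I = ℕ × ℕ for Cauchy.
private
  module Null {I : Set} (T : ℕ → I → Set)
              (T-mono : ∀ {M N i} → M ℕ.≤ N → T N i → T M i) where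

    Null : (I → ℚ) → Set
    Null f = ∀ ε → 0ℚ ℚ.< ε → ∃[ N ] (∀ i → T N i → ∣ f i ∣ ℚ.< ε)

    Bounded : (I → ℚ) → Set
    Bounded f = ∃[ K ] 0ℚ ℚ.< K × ∃[ N ] (∀ i → T N i → ∣ f i ∣ ℚ.≤ K)

    null-resp : ∀ {f g} → (∀ i → f i ≡ g i) → Null f → Null g
    null-resp eq h ε ε>0 with N , p ← h ε ε>0 =
      N , λ i t → subst (λ q → ∣ q ∣ ℚ.< ε) (eq i) (p i t)

    null-+ : ∀ {f g} → Null f → Null g → Null (λ i → f i ℚ.+ g i)
    null-+ {f} {g} hf hg ε ε>0 = M ℕ.⊔ N , λ i t → begin-strict
        ∣ f i ℚ.+ g i ∣          ≤⟨ ℚ.∣p+q∣≤∣p∣+∣q∣ (f i) (g i) ⟩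
        ∣ f i ∣ ℚ.+ ∣ g i ∣      <⟨ ℚ.+-mono-< (p i (T-mono (ℕ.m≤m⊔n M N) t))
                                               (q i (T-mono (ℕ.m≤n⊔m M N) t)) ⟩
        ½ ℚ.* ε ℚ.+ ½ ℚ.* ε      ≡⟨ sym (ℚ.*-distribʳ-+ ε ½ ½) ⟩
        1ℚ ℚ.* ε                 ≡⟨ ℚ.*-identityˡ ε ⟩
        ε                        ∎
      where
      open ℚ.≤-Reasoning
      ½ε>0 : 0ℚ ℚ.< ½ ℚ.* ε
      ½ε>0 = subst (ℚ._< ½ ℚ.* ε) (ℚ.*-zeroʳ ½) (ℚ.*-monoʳ-<-pos ½ ε>0)
      M = Σ.proj₁ (hf _ ½ε>0)
      p = Σ.proj₂ (hf _ ½ε>0)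
      N = Σ.proj₁ (hg _ ½ε>0)
      q = Σ.proj₂ (hg _ ½ε>0)

    null-neg : ∀ {f} → Null f → Null (λ i → ℚ.- f i)
    null-neg {f} h ε ε>0 with N , p ← h ε ε>0 =
      N , λ i t → subst (ℚ._< ε) (sym (ℚ.∣-p∣≡∣p∣ (f i))) (p i t)

    null-* : ∀ {f g} → Bounded f → Null g → Null (λ i → f i ℚ.* g i)
    null-* {f} {g} (K , K>0 , M , b) hg ε ε>0 = M ℕ.⊔ N , λ i t → begin-strict
        ∣ f i ℚ.* g i ∣          ≡⟨ ℚ.∣p*q∣≡∣p∣*∣q∣ (f i) (g i) ⟩
        ∣ f i ∣ ℚ.* ∣ g i ∣      ≤⟨ ℚ.*-monoʳ-≤-nonNeg ∣ g i ∣ {{ℚ.∣-∣-nonNeg (g i)}}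
                                      (b i (T-mono (ℕ.m≤m⊔n M N) t)) ⟩
        K ℚ.* ∣ g i ∣            <⟨ ℚ.*-monoʳ-<-pos K (q i (T-mono (ℕ.m≤n⊔m M N) t)) ⟩
        K ℚ.* (K⁻¹ ℚ.* ε)        ≡⟨ sym (ℚ.*-assoc K K⁻¹ ε) ⟩
        K ℚ.* K⁻¹ ℚ.* ε          ≡⟨ cong (ℚ._* ε) (ℚ.*-inverseʳ K) ⟩
        1ℚ ℚ.* ε                 ≡⟨ ℚ.*-identityˡ ε ⟩
        ε                        ∎
      where
      open ℚ.≤-Reasoning
      instance
        K-pos : ℚ.Positive K
        K-pos = ℚ.positive K>0
        K-nonZero : ℚ.NonZero K
        K-nonZero = ℚ.pos⇒nonZero K
      K⁻¹ = ℚ.1/ K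
      instance
        K⁻¹-pos : ℚ.Positive K⁻¹
        K⁻¹-pos = ℚ.1/pos⇒pos K
      δ>0 : 0ℚ ℚ.< K⁻¹ ℚ.* ε
      δ>0 = subst (ℚ._< K⁻¹ ℚ.* ε) (ℚ.*-zeroʳ K⁻¹) (ℚ.*-monoʳ-<-pos K⁻¹ ε>0)
      N = Σ.proj₁ (hg _ δ>0)
      q = Σ.proj₂ (hg _ δ>0)

  module Null₁ = Null {ℕ} ℕ._≤_ ℕ.≤-trans
  module Null₂ = Null {ℕ × ℕ} (λ N (m , n) → N ℕ.≤ m × N ℕ.≤ n)
                      (λ M≤N (p , q) → ℕ.≤-trans M≤N p , ℕ.≤-trans M≤N q)

  fromCauchy : ∀ x → Null₂.Null (λ (m , n) → seq x m ℚ.- seq x n)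
  fromCauchy (mkℝ _ h) ε ε>0 with N , p ← h ε ε>0 = N , λ (m , n) (a , b) → p m n a b

  toCauchy : ∀ x → Null₂.Null (λ (m , n) → x m ℚ.- x n) → Cauchy x
  toCauchy _ h ε ε>0 with N , p ← h ε ε>0 = N , λ m n a b → p (m , n) (a , b)

  -‿interchange : ∀ a b c d → (a ℚ.- b) ℚ.+ (c ℚ.- d) ≡ (a ℚ.+ c) ℚ.- (b ℚ.+ d)
  -‿interchange = solve 4 (λ a b c d → (a :- b) :+ (c :- d) := (a :+ c) :- (b :+ d)) refl
    where open +-*-Solver

  *-difference : ∀ a b c d → a ℚ.* (c ℚ.- d) ℚ.+ d ℚ.* (a ℚ.- b) ≡ a ℚ.* c ℚ.- b ℚ.* d
  *-difference = solve 4 (λ a b c d → a :* (c :- d) :+ d :* (a :- b) := a :* c :- b :* d) refl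
    where open +-*-Solver

  -‿swap : ∀ a b → ℚ.- (a ℚ.- b) ≡ b ℚ.- a
  -‿swap = solve 2 (λ a b → :- (a :- b) := b :- a) refl
    where open +-*-Solver

  -‿distrib : ∀ a b → ℚ.- (a ℚ.- b) ≡ ℚ.- a ℚ.- ℚ.- b
  -‿distrib = solve 2 (λ a b → :- (a :- b) := :- a :- :- b) refl
    where open +-*-Solver

  -‿telescope : ∀ a b c → (a ℚ.- b) ℚ.+ (b ℚ.- c) ≡ a ℚ.- c
  -‿telescope = solve 3 (λ a b c → (a :- b) :+ (b :- c) := a :- c) refl
    where open +-*-Solver

  -‿cancel : ∀ a b → (a ℚ.- b) ℚ.+ b ≡ a
  -‿cancel = solve 2 (λ a b → (a :- b) :+ b := a) refl
    where open +-*-Solver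

  bounded : ∀ x → Null₁.Bounded (seq x)
  bounded (mkℝ x h) with N , p ← h 1ℚ (ℚ.positive⁻¹ 1ℚ) =
    1ℚ ℚ.+ ∣ x N ∣ ,
    ℚ.<-≤-trans (ℚ.positive⁻¹ 1ℚ)
      (subst (ℚ._≤ 1ℚ ℚ.+ ∣ x N ∣) (ℚ.+-identityʳ 1ℚ) (ℚ.+-monoʳ-≤ 1ℚ (ℚ.0≤∣p∣ (x N)))) ,
    N , λ n N≤n → begin
      ∣ x n ∣                        ≡⟨ cong ∣_∣ (sym (-‿cancel (x n) (x N))) ⟩
      ∣ x n ℚ.- x N ℚ.+ x N ∣        ≤⟨ ℚ.∣p+q∣≤∣p∣+∣q∣ (x n ℚ.- x N) (x N) ⟩
      ∣ x n ℚ.- x N ∣ ℚ.+ ∣ x N ∣    ≤⟨ ℚ.+-monoˡ-≤ ∣ x N ∣ (ℚ.<⇒≤ (p n N N≤n ℕ.≤-refl)) ⟩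
      1ℚ ℚ.+ ∣ x N ∣                 ∎
    where open ℚ.≤-Reasoning

  bounded-fst : ∀ x → Null₂.Bounded (λ (m , n) → seq x m)
  bounded-fst x = let K , K>0 , N , b = bounded x in K , K>0 , N , λ (m , n) (p , q) → b m p

  bounded-snd : ∀ x → Null₂.Bounded (λ (m , n) → seq x n)
  bounded-snd x = let K , K>0 , N , b = bounded x in K , K>0 , N , λ (m , n) (p , q) → b n q

constCauchy : ∀ q → Cauchy (λ _ → q)
constCauchy q ε ε>0 = 0 , λ _ _ _ _ →
  subst (λ r → ∣ r ∣ ℚ.< ε) (sym (ℚ.+-inverseʳ q)) ε>0

fromℚ : ℚ → ℝ
fromℚ q = mkℝ (λ _ → q) (constCauchy q)

0ℝ 1ℝ : ℝ
0ℝ = fromℚ 0ℚ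
1ℝ = fromℚ 1ℚ

infixl 6 _+ℝ_
infixl 7 _*ℝ_
infix  8 -ℝ_

_+ℝ_ : ℝ → ℝ → ℝ
x +ℝ y = mkℝ (λ n → seq x n ℚ.+ seq y n)
  (toCauchy (λ n → seq x n ℚ.+ seq y n) (Null₂.null-resp
    (λ (m , n) → -‿interchange (seq x m) (seq x n) (seq y m) (seq y n))
    (Null₂.null-+ (fromCauchy x) (fromCauchy y))))

-ℝ_ : ℝ → ℝ
-ℝ x = mkℝ (λ n → ℚ.- seq x n)
  (toCauchy (λ n → ℚ.- seq x n) (Null₂.null-resp
    (λ (m , n) → -‿distrib (seq x m) (seq x n))
    (Null₂.null-neg (fromCauchy x))))

_*ℝ_ : ℝ → ℝ → ℝ
x *ℝ y = mkℝ (λ n → seq x n ℚ.* seq y n)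
  (toCauchy (λ n → seq x n ℚ.* seq y n) (Null₂.null-resp
    (λ (m , n) → *-difference (seq x m) (seq x n) (seq y m) (seq y n))
    (Null₂.null-+ (Null₂.null-* (bounded-fst x) (fromCauchy y))
                  (Null₂.null-* (bounded-snd y) (fromCauchy x)))))

≗⇒≈ : ∀ {x y} → (∀ n → seq x n ≡ seq y n) → x ≈ y
≗⇒≈ {x} {y} eq = mk≈ λ ε ε>0 → 0 , λ n _ →
  subst (λ r → ∣ r ∣ ℚ.< ε)
        (sym (trans (cong (ℚ._- seq y n) (eq n)) (ℚ.+-inverseʳ (seq y n)))) ε>0

ℝ-isCommutativeRing : IsCommutativeRing _≈_ _+ℝ_ _*ℝ_ -ℝ_ 0ℝ 1ℝ
ℝ-isCommutativeRing = record
  { isRing = record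
    { +-isAbelianGroup = record
      { isGroup = record
        { isMonoid = record
          { isSemigroup = record
            { isMagma = record
              { isEquivalence = record
                { refl  = ≗⇒≈ λ _ → refl
                ; sym   = λ {x} {y} p → mk≈ (Null₁.null-resp
                    (λ n → -‿swap (seq x n) (seq y n))
                    (Null₁.null-neg (diff→0 p)))
                ; trans = λ {x} {y} {z} p q → mk≈ (Null₁.null-resp
                    (λ n → -‿telescope (seq x n) (seq y n) (seq z n))
                    (Null₁.null-+ (diff→0 p) (diff→0 q)))
                }
              ; ∙-cong = λ {x} {y} {u} {v} p q → mk≈ (Null₁.null-resp
                  (λ n → -‿interchange (seq x n) (seq y n) (seq u n) (seq v n))
                  (Null₁.null-+ (diff→0 p) (diff→0 q)))
              }
            ; assoc = λ x y z → ≗⇒≈ λ n → ℚ.+-assoc (seq x n) (seq y n) (seq z n)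
            }
          ; identity = (λ x → ≗⇒≈ λ n → ℚ.+-identityˡ (seq x n))
                     , (λ x → ≗⇒≈ λ n → ℚ.+-identityʳ (seq x n))
          }
        ; inverse = (λ x → ≗⇒≈ λ n → ℚ.+-inverseˡ (seq x n))
                  , (λ x → ≗⇒≈ λ n → ℚ.+-inverseʳ (seq x n))
        ; ⁻¹-cong = λ {x} {y} p → mk≈ (Null₁.null-resp
            (λ n → -‿distrib (seq x n) (seq y n))
            (Null₁.null-neg (diff→0 p)))
        }
      ; comm = λ x y → ≗⇒≈ λ n → ℚ.+-comm (seq x n) (seq y n)
      }
    ; *-cong = λ {x} {y} {u} {v} p q → mk≈ (Null₁.null-resp
        (λ n → *-difference (seq x n) (seq y n) (seq u n) (seq v n))
        (Null₁.null-+ (Null₁.null-* (bounded x) (diff→0 q))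
                      (Null₁.null-* (bounded v) (diff→0 p))))
    ; *-assoc = λ x y z → ≗⇒≈ λ n → ℚ.*-assoc (seq x n) (seq y n) (seq z n)
    ; *-identity = (λ x → ≗⇒≈ λ n → ℚ.*-identityˡ (seq x n))
                 , (λ x → ≗⇒≈ λ n → ℚ.*-identityʳ (seq x n))
    ; distrib = (λ x y z → ≗⇒≈ λ n → ℚ.*-distribˡ-+ (seq x n) (seq y n) (seq z n))
              , (λ x y z → ≗⇒≈ λ n → ℚ.*-distribʳ-+ (seq x n) (seq y n) (seq z n))
    }
  ; *-comm = λ x y → ≗⇒≈ λ n → ℚ.*-comm (seq x n) (seq y n)
  }

ℝ-commutativeRing : CommutativeRing 0ℓ 0ℓ
ℝ-commutativeRing = record { isCommutativeRing = ℝ-isCommutativeRing }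

module Matrices {c ℓ} (R : CommutativeRing c ℓ) where
  open CommutativeRing R using (Carrier; _*_; _-_; -_; 0#; 1#; semiring; +-commutativeMonoid)
  open import Algebra.Properties.CommutativeMonoid.Sum +-commutativeMonoid using (sum)
  open import Algebra.Properties.Semiring.Exp semiring using (_^_)

  SquareMatrix : ℕ → Set c
  SquareMatrix n = Fin n → Fin n → Carrier

  -- Laplace expansion along the first row.
  det : ∀ {n} → SquareMatrix n → Carrier
  det {zero}  A = 1#
  det {suc n} A = sum λ j → (- 1#) ^ toℕ j * A zero j * det (λ i k → A (suc i) (punchIn j k))

  scalar : ∀ n → Carrier → SquareMatrix n
  scalar n x i j = if does (i Fin.≟ j) then x else 0#

  -- The value at x of the characteristic polynomial det (xI - A).
  charPoly : ∀ {n} → SquareMatrix n → Carrier → Carrier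
  charPoly {n} A x = det λ i j → scalar n x i j - A i j

record Graph : Set₁ where
  field
    Vertex      : Set
    order       : ℕ
    enumeration : Fin order ↔ Vertex
    Adj         : Rel Vertex 0ℓ
    adj?        : ∀ x y → Dec (Adj x y)
    adj-sym     : Symmetric Adj
    adj-irrefl  : ∀ {x} → ¬ Adj x x

record _≅_ (G H : Graph) : Set where
  private
    module G = Graph G
    module H = Graph H
  field
    bijection : G.Vertex ↔ H.Vertex
    preserves : ∀ x y → G.Adj x y ⇔ H.Adj (Inverse.to bijection x) (Inverse.to bijection y)

open Matrices ℝ-commutativeRing public
open CommutativeRing ℝ-commutativeRing using (setoid; _-_)
open import Data.List.Relation.Binary.Permutation.Setoid setoid using (_↭_)

adjacencyMatrix : (G : Graph) → SquareMatrix (Graph.order G)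
adjacencyMatrix G i j = if does (adj? (vertex i) (vertex j)) then 1ℝ else 0ℝ
  where
  open Graph G
  vertex = Inverse.to enumeration

-- The list Λ contains the eigenvalues of the adjacency matrix A, each
-- repeated according to its multiplicity as a root of det (xI - A), i.e.
-- det (xI - A) = ∏ (x - μ) over μ in Λ. Real polynomials agree when they
-- agree at every real x. As A is symmetric, all its eigenvalues are real.
HasSpectrum : Graph → List ℝ → Set
HasSpectrum G Λ =
  ∀ x → charPoly (adjacencyMatrix G) x ≈ foldr _*ℝ_ 1ℝ (map (λ μ → x - μ) Λ)

Cospectral : Graph → Graph → Set
Cospectral G H = ∃[ Λ ] ∃[ M ] HasSpectrum G Λ × HasSpectrum H M × Λ ↭ M

DS : Graph → Set₁
DS G = ∀ H → Cospectral H G → H ≅ G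

record FiniteGroup : Set₁ where
  infixl 7 _∙_
  infix  8 _⁻¹
  field
    Carrier     : Set
    order       : ℕ
    enumeration : Fin order ↔ Carrier
    _∙_         : Carrier → Carrier → Carrier
    ε           : Carrier
    _⁻¹         : Carrier → Carrier
    isGroup     : IsGroup _≡_ _∙_ ε _⁻¹

  group : Group 0ℓ 0ℓ
  group = record { isGroup = isGroup }

record ConnectionSet (G : FiniteGroup) : Set₁ where
  open FiniteGroup G
  field
    Member         : Carrier → Set
    member?        : ∀ x → Dec (Member x)
    inverse-closed : ∀ {x} → Member x → Member (x ⁻¹)
    ε∉             : ¬ Member ε

Cay : (G : FiniteGroup) → ConnectionSet G → Graph
Cay G H = record
  { Vertex      = Carrier
  ; order       = order
  ; enumeration = enumeration
  ; Adj         = λ x y → Member (x ⁻¹ ∙ y)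
  ; adj?        = λ x y → member? (x ⁻¹ ∙ y)
  ; adj-sym     = λ {x} {y} h → subst Member
      (trans (⁻¹-anti-homo-∙ (x ⁻¹) y) (cong (y ⁻¹ ∙_) (⁻¹-involutive x)))
      (inverse-closed h)
  ; adj-irrefl  = λ {x} h → ε∉ (subst Member (inverseˡ x) h)
  }
  where
  open FiniteGroup G
  open ConnectionSet H
  open IsGroup isGroup using (inverseˡ)
  open import Algebra.Properties.Group group using (⁻¹-anti-homo-∙; ⁻¹-involutive)

module _ (n : ℕ) .{{_ : NonZero n}} where

  addMod : Fin n → Fin n → Fin n
  addMod a b = (toℕ a ℕ.+ toℕ b) mod n

  negMod : Fin n → Fin n
  negMod a = (n ℕ.∸ toℕ a) mod n

  private
    toℕ-mod : ∀ k → toℕ (k mod n) ≡ k % n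
    toℕ-mod k = Fin.toℕ-fromℕ< (m%n<n k n)

    toℕ-% : ∀ a → toℕ a % n ≡ toℕ {n} a
    toℕ-% a = m<n⇒m%n≡m (Fin.toℕ<n a)

    %-+ˡ : ∀ k l → (k % n ℕ.+ l) % n ≡ (k ℕ.+ l) % n
    %-+ˡ k l = trans (%-distribˡ-+ (k % n) l n)
      (trans (cong (λ r → (r ℕ.+ l % n) % n) (m%n%n≡m%n k n)) (sym (%-distribˡ-+ k l n)))

    comm : ∀ a b → addMod a b ≡ addMod b a
    comm a b = cong (_mod n) (ℕ.+-comm (toℕ a) (toℕ b))

    toℕ-addˡ : ∀ k b → toℕ (addMod (k mod n) b) ≡ (k ℕ.+ toℕ b) % n
    toℕ-addˡ k b = trans (toℕ-mod _)
      (trans (cong (λ r → (r ℕ.+ toℕ b) % n) (toℕ-mod k)) (%-+ˡ k (toℕ b)))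

    assoc : ∀ a b c → addMod (addMod a b) c ≡ addMod a (addMod b c)
    assoc a b c = Fin.toℕ-injective (begin
      toℕ (addMod (addMod a b) c)             ≡⟨ toℕ-addˡ (toℕ a ℕ.+ toℕ b) c ⟩
      (toℕ a ℕ.+ toℕ b ℕ.+ toℕ c) % n         ≡⟨ cong (_% n) (ℕ.+-assoc (toℕ a) (toℕ b) (toℕ c)) ⟩
      (toℕ a ℕ.+ (toℕ b ℕ.+ toℕ c)) % n       ≡⟨ cong (_% n) (ℕ.+-comm (toℕ a) _) ⟩
      (toℕ b ℕ.+ toℕ c ℕ.+ toℕ a) % n         ≡⟨ toℕ-addˡ (toℕ b ℕ.+ toℕ c) a ⟨
      toℕ (addMod (addMod b c) a)             ≡⟨ cong toℕ (comm (addMod b c) a) ⟩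
      toℕ (addMod a (addMod b c))             ∎)
      where open ≡-Reasoning

    identityˡ : ∀ a → addMod (0 mod n) a ≡ a
    identityˡ a = Fin.toℕ-injective (trans (toℕ-addˡ 0 a) (toℕ-% a))

    inverseˡ : ∀ a → addMod (negMod a) a ≡ 0 mod n
    inverseˡ a = Fin.toℕ-injective (begin
      toℕ (addMod (negMod a) a)               ≡⟨ toℕ-addˡ (n ℕ.∸ toℕ a) a ⟩
      (n ℕ.∸ toℕ a ℕ.+ toℕ a) % n             ≡⟨ cong (_% n) (ℕ.m∸n+n≡m (ℕ.<⇒≤ (Fin.toℕ<n a))) ⟩
      n % n                                   ≡⟨ n%n≡0 n ⟩
      0                                       ≡⟨ m<n⇒m%n≡m (ℕ.>-nonZero⁻¹ n) ⟨
      0 % n                                   ≡⟨ toℕ-mod 0 ⟨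
      toℕ (0 mod n)                           ∎)
      where open ≡-Reasoning

  ℤ/ : FiniteGroup
  ℤ/ = record
    { Carrier     = Fin n
    ; order       = n
    ; enumeration = ↔-id (Fin n)
    ; _∙_         = addMod
    ; ε           = 0 mod n
    ; _⁻¹         = negMod
    ; isGroup     = record
      { isMonoid = record
        { isSemigroup = record
          { isMagma = record { isEquivalence = isEquivalence ; ∙-cong = cong₂ addMod }
          ; assoc   = assoc
          }
        ; identity = identityˡ , λ a → trans (comm a (0 mod n)) (identityˡ a)
        }
      ; inverse = inverseˡ , λ a → trans (comm a (negMod a)) (inverseˡ a)
      ; ⁻¹-cong = cong negMod
      }
    }

  coprimeResidues : NonTrivial n → ConnectionSet ℤ/
  coprimeResidues n>1 = record
    { Member         = λ a → gcd (toℕ a) n ≡ 1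
    ; member?        = λ a → gcd (toℕ a) n ℕ.≟ 1
    ; inverse-closed = λ {a} h → Coprimality.coprime⇒gcd≡1 λ {d} (d∣-a , d∣n) →
        Coprimality.gcd≡1⇒coprime h (∣a a d∣n (subst (d ∣_) (toℕ-mod _) d∣-a) , d∣n)
    ; ε∉             = λ h → ℕ.nonTrivial⇒≢1 {{n>1}} (trans (sym (gcd-identityˡ n))
        (subst (λ r → gcd r n ≡ 1) (trans (toℕ-mod 0) (m<n⇒m%n≡m (ℕ.>-nonZero⁻¹ n))) h))
    }
    where
    ∣a : ∀ a {d} → d ∣ n → d ∣ (n ℕ.∸ toℕ {n} a) % n → d ∣ toℕ a
    ∣a a {d} d∣n d∣r = ∣m+n∣m⇒∣n
      (subst (d ∣_) (sym (ℕ.m∸n+n≡m (ℕ.<⇒≤ (Fin.toℕ<n a)))) d∣n)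
      (∣n∣m%n⇒∣m d∣n d∣r)

primePower-nonTrivial : ∀ {p m} → Prime p → m ℕ.≥ 1 → NonTrivial (p ℕ.^ m)
primePower-nonTrivial {p} {suc m} pr _ = ℕ.n>1⇒nonTrivial
  (ℕ.<-≤-trans (ℕ.nonTrivial⇒n>1 p {{prime⇒nonTrivial pr}})
               (ℕ.m≤m*n p (p ℕ.^ m) {{ℕ.m^n≢0 p m {{prime⇒nonZero pr}}}}))

-- Cay(ℤ_n, S) with S = { a ∈ ℤ_n ∣ gcd(a, n) = 1 }; n > 1 is what keeps 0 out of S.
unitaryCayleyGraph : (n : ℕ) → NonTrivial n → Graph
unitaryCayleyGraph n n>1 = Cay (ℤ/ n) (coprimeResidues n n>1)
  where
  instance
    n≢0 : NonZero n
    n≢0 = ℕ.nonTrivial⇒nonZero n {{n>1}}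

{-# OPTIONS --safe #-}
module Submission where

open import Algebra.Bundles using (CommutativeRing)
open import Algebra.Morphism.Structures using (module RingMorphisms)
import Algebra.Properties.Group
open import Data.Bool.Base using (true; false; if_then_else_)
open import Data.Fin.Base as Fin using (Fin; zero; suc; punchIn; punchOut; toℕ; remQuot; combine)
import Data.Fin.Properties as Fin
import Data.Integer.Base as ℤ
import Data.Integer.Properties as ℤ
open import Data.Integer.Solver using (module +-*-Solver)
open import Data.List.Base using (List; foldr; map; length; filter; tabulate; lookup; allFin)
import Data.List.Properties as List
open import Data.List.Membership.Propositional using (_∈_)
open import Data.List.Membership.Propositional.Properties using (∈-filter⁻; ∈-lookup)
import Data.List.Relation.Unary.All as All
open import Data.List.Relation.Unary.Any using (here)
open import Data.List.Relation.Unary.Unique.Propositional using (Unique)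
import Data.List.Relation.Unary.Unique.Propositional.Properties as Unique
open import Data.Nat.Base as ℕ using (ℕ; zero; suc; NonZero; NonTrivial; _≥_)
open import Data.Nat.Coprimality as Coprimality using (Coprime; coprime⇒gcd≡1; gcd≡1⇒coprime; coprime-divisor)
open import Data.Nat.DivMod using (_%_; m%n<n; %-distribˡ-+; %-remove-+ʳ; [m+n]%n≡m%n; m<n⇒m%n≡m; m∣n⇒o%n%m≡o%m)
open import Data.Nat.Divisibility using (_∣_; divides; ∣-trans; ∣m+n∣m⇒∣n; m%n≡0⇒n∣m; n∣m⇒m%n≡0; m∣m*n; ∣1⇒≡1)
open import Data.Nat.GCD using (gcd)
open import Data.Nat.Primality using (Prime; prime⇒nonZero; prime⇒nonTrivial; prime⇒irreducible)
import Data.Nat.Properties as ℕ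
open import Data.Product.Base using (_×_; _,_; proj₁; proj₂; ∃-syntax; Σ-syntax; uncurry)
open import Data.Rational.Base as ℚ using (ℚ; 0ℚ; mkℚ)
import Data.Rational.Properties as ℚ
import Data.Rational.Unnormalised.Base as ℚᵘ
import Data.Rational.Unnormalised.Properties as ℚᵘ
open import Data.Sum.Base using (_⊎_; inj₁; inj₂)
open import Function.Base using (_∘_; id)
open import Function.Bundles using (Inverse; _↔_; mk↔ₛ′; _⇔_; mk⇔; Equivalence)
open import Function.Properties.Inverse using (↔-sym; ↔-trans)
open import Level using (_⊔_)
open import Relation.Binary.Definitions using (Decidable; Symmetric; Transitive; tri<; tri≈; tri>)
open import Relation.Binary.PropositionalEquality as ≡ using (_≡_; _≢_; _≗_)
open import Relation.Nullary.Decidable using (Dec; does; yes; no; dec-true; dec-false; does-⇔)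
open import Relation.Nullary.Negation using (¬_; contradiction)
import Relation.Unary as Unary
open import Relation.Unary.Properties using (∁?)
open import Defs using (module Matrices; Graph; _≅_; FiniteGroup; Cospectral; HasSpectrum)
open import Defs using (DS; unitaryCayleyGraph; primePower-nonTrivial)

-- Let n = p q with q = p^(m-1). The graph is complete multipartite with p
-- parts of size q; writing k = n - q, its adjacency matrix A satisfies
-- A² + q A = k J, and conversely every graph with A² + q A = k J is such
-- a multipartite graph.
--
-- Let H be cospectral and B = A² + q A for its adjacency matrix A. Since
-- r(r+q) I - B = (r I - A) ((r+q) I + A), multiplicativity of det shows
-- that the characteristic polynomial of A determines that of B, and hence
-- (the same argument once more) that of B². So n, tr B = n k and
-- tr B² = n² k² are the same for H. With dᵢ = Bᵢᵢ the degrees of H,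
-- ∑ᵢⱼ (Bᵢⱼ - k)² + 2 k ∑ᵢ (dᵢ - k)² = tr B² - n² k² = 0, so B = k J.
-- No spectral theorem is needed, and the identities take place over ℤ.

-- Determinants

-- The complete multipartite graph has no eigenvalues other than k, 0 and -q. The polynomial x² + q
-- x vanishes at the last two and takes the value k (k + q) = n k at the first, which is the nonzero
-- eigenvalue of k J. The obstacle is that H is not known to be regular. Expanding ∑ᵢⱼ (Bᵢⱼ - k)²
-- brings in the sum of all entries of A², which is the sum of the squared degrees and in general no
-- spectral invariant. It enters with the coefficient -2 k, so adding 2 k ∑ᵢ (dᵢ - k)² cancels it.
-- What is left is a multiple of n - (k + q), and k ≥ 0 keeps both summands nonnegative. The
-- factorisation gives the characteristic polynomial of B only at the points r (r + q); an identity
-- theorem for polynomial functions on ℤ covers the other points. The spectrum lives in Cauchy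
-- reals, but at an integer argument the characteristic polynomial of a graph is an integer, and the
-- embedding of ℤ reflects equality.

module Determinants {c ℓ} (R : CommutativeRing c ℓ) where
  open CommutativeRing R hiding (zero)
  open Matrices R
  open import Data.Vec.Functional using (_∷_; tail; insertAt)
  open import Data.Vec.Functional.Properties using (insertAt-lookup; insertAt-punchIn)
  open import Algebra.Properties.Ring ring using (x+x≈x⇒x≈0; -1*x≈-x; -‿involutive; +-inverseˡ-unique)
  open import Algebra.Properties.Semiring.Sum semiring
    using (sum; sum-cong-≋; sum-replicate-zero; ∑-distrib-+; *-distribˡ-sum; *-distribʳ-sum; ∑-comm)
  open import Algebra.Properties.Semiring.Exp semiring using (_^_)
  open import Algebra.Solver.Ring.NaturalCoefficients.Default commutativeSemiring
    using (solve; _:+_; _:*_; _:=_; con)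
  open import Relation.Binary.Reasoning.Setoid setoid

  Rows : ℕ → ℕ → Set c
  Rows m n = Fin m → Fin n → Carrier

  infix 4 _≋_
  _≋_ : ∀ {m n} → Rows m n → Rows m n → Set ℓ
  X ≋ Y = ∀ i j → X i j ≈ Y i j

  -- Copies of sum and det that do not unfold, so that unification can recover their arguments.
  opaque
    ∑ : ∀ {n} → (Fin n → Carrier) → Carrier
    ∑ = sum

    Det : ∀ {n} → SquareMatrix n → Carrier
    Det = det

  opaque
    unfolding ∑

    ∑-cong : ∀ {n} {f g : Fin n → Carrier} → (∀ i → f i ≈ g i) → ∑ f ≈ ∑ g
    ∑-cong = sum-cong-≋

    ∑-empty : {f : Fin 0 → Carrier} → ∑ f ≈ 0#
    ∑-empty = refl

    ∑-suc : ∀ {n} (f : Fin (suc n) → Carrier) → ∑ f ≈ f zero + ∑ (f ∘ suc)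
    ∑-suc f = refl

    ∑-zero : ∀ {n} {f : Fin n → Carrier} → (∀ i → f i ≈ 0#) → ∑ f ≈ 0#
    ∑-zero {n} h = trans (sum-cong-≋ h) (sum-replicate-zero n)

    ∑-+ : ∀ {n} (f g : Fin n → Carrier) → ∑ (λ i → f i + g i) ≈ ∑ f + ∑ g
    ∑-+ = ∑-distrib-+

    ∑-*ˡ : ∀ {n} a (f : Fin n → Carrier) → ∑ (λ i → a * f i) ≈ a * ∑ f
    ∑-*ˡ a f = sym (*-distribˡ-sum a f)

    ∑-*ʳ : ∀ {n} a (f : Fin n → Carrier) → ∑ (λ i → f i * a) ≈ ∑ f * a
    ∑-*ʳ a f = sym (*-distribʳ-sum a f)

    ∑-swap : ∀ {m n} (f : Fin m → Fin n → Carrier) → ∑ (λ i → ∑ (f i)) ≈ ∑ (λ j → ∑ (λ i → f i j))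
    ∑-swap = ∑-comm

  ∑-linear : ∀ {n} a (f g : Fin n → Carrier) → ∑ (λ j → a * f j + g j) ≈ a * ∑ f + ∑ g
  ∑-linear a f g = trans (∑-+ _ _) (+-congʳ (∑-*ˡ a f))

  identity : ∀ n → SquareMatrix n
  identity n = scalar n 1#

  scalar-diagonal : ∀ {n} x i → scalar n x i i ≈ x
  scalar-diagonal x i rewrite dec-true (i Fin.≟ i) ≡.refl = refl

  scalar-off-diagonal : ∀ {n} x {i j} → i ≢ j → scalar n x i j ≈ 0#
  scalar-off-diagonal x {i} {j} i≢j rewrite dec-false (i Fin.≟ j) i≢j = refl

  ∑-scalarʳ : ∀ {n} x (v : Fin n → Carrier) j → ∑ (λ l → v l * scalar n x l j) ≈ v j * x
  ∑-scalarʳ x v zero = begin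
    ∑ (λ l → v l * scalar _ x l zero)        ≈⟨ ∑-suc _ ⟩
    v zero * x + ∑ (λ l → v (suc l) * 0#)    ≈⟨ +-congˡ (∑-zero λ l → zeroʳ _) ⟩
    v zero * x + 0#                          ≈⟨ +-identityʳ _ ⟩
    v zero * x                               ∎
  ∑-scalarʳ {suc n} x v (suc j) = begin
    ∑ (λ l → v l * scalar (suc n) x l (suc j))
      ≈⟨ ∑-suc _ ⟩
    v zero * 0# + ∑ (λ l → v (suc l) * scalar n x l j)
      ≈⟨ trans (+-congʳ (zeroʳ _)) (+-identityˡ _) ⟩
    ∑ (λ l → v (suc l) * scalar n x l j)
      ≈⟨ ∑-scalarʳ x (v ∘ suc) j ⟩
    v (suc j) * x ∎

  scalar-sym : ∀ {n} x i j → scalar n x i j ≈ scalar n x j i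
  scalar-sym x i j with i Fin.≟ j
  ... | yes ≡.refl = sym (scalar-diagonal x i)
  ... | no i≢j     = sym (scalar-off-diagonal x (i≢j ∘ ≡.sym))

  ∑-scalarˡ : ∀ {n} x i (v : Fin n → Carrier) → ∑ (λ l → scalar n x i l * v l) ≈ x * v i
  ∑-scalarˡ {n} x i v = begin
    ∑ (λ l → scalar n x i l * v l)    ≈⟨ ∑-cong (λ l → trans (*-comm _ _) (*-congˡ (scalar-sym x i l))) ⟩
    ∑ (λ l → v l * scalar n x l i)    ≈⟨ ∑-scalarʳ x v i ⟩
    v i * x                           ≈⟨ *-comm _ _ ⟩
    x * v i                           ∎

  -- Multilinear and alternating functions of the rows

  record Multilinear {m n} (F : Rows m n → Carrier) : Set (c ⊔ ℓ) where
    field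
      congruent : ∀ {X Y} → X ≋ Y → F X ≈ F Y
      -- The three matrices are related by equations between entries instead of being built by
      -- updating a row, so that each use can supply them in whatever shape they already have.
      linear    : ∀ i a {X Y Z} → (∀ j → Z i j ≈ a * X i j + Y i j) →
                  (∀ k → k ≢ i → ∀ j → X k j ≈ Z k j) →
                  (∀ k → k ≢ i → ∀ j → Y k j ≈ Z k j) →
                  F Z ≈ a * F X + F Y

  open Multilinear

  ∷-eta : ∀ {m n} (X : Rows (suc m) n) → X ≋ X zero ∷ tail X
  ∷-eta X zero    j = refl
  ∷-eta X (suc i) j = refl

  ∷-cong : ∀ {m n} {u v : Fin n → Carrier} {X Y : Rows m n} →
           (∀ j → u j ≈ v j) → X ≋ Y → u ∷ X ≋ v ∷ Y
  ∷-cong u≈v X≋Y zero    j = u≈v j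
  ∷-cong u≈v X≋Y (suc i) j = X≋Y i j

  linear₀ : ∀ {m n} {F : Rows (suc m) n → Carrier} → Multilinear F →
            ∀ a {u v w T} → (∀ j → w j ≈ a * u j + v j) →
            F (w ∷ T) ≈ a * F (u ∷ T) + F (v ∷ T)
  linear₀ ml a eq = linear ml zero a eq (λ { zero 0≢0 → contradiction ≡.refl 0≢0 ; (suc k) _ j → refl })
                                       (λ { zero 0≢0 → contradiction ≡.refl 0≢0 ; (suc k) _ j → refl })

  fix-head : ∀ {m n} {F : Rows (suc m) n → Carrier} → Multilinear F →
             ∀ v → Multilinear (λ T → F (v ∷ T))
  fix-head ml v = record
    { congruent = λ T≋ → congruent ml (∷-cong (λ _ → refl) T≋)
    ; linear    = λ i a eq X≈Z Y≈Z → linear ml (suc i) a eq (other X≈Z) (other Y≈Z)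
    }
    where
    other : ∀ {m i} {X Z : Rows m _} → (∀ k → k ≢ i → ∀ j → X k j ≈ Z k j) →
            ∀ k → k ≢ suc i → ∀ j → (v ∷ X) k j ≈ (v ∷ Z) k j
    other X≈Z zero    _     j = refl
    other X≈Z (suc k) k≢i j = X≈Z k (k≢i ∘ ≡.cong suc) j

  -- A zero row is the sum of itself with itself, whence F X = F X + F X.
  zero-row : ∀ {m n} {F : Rows m n → Carrier} → Multilinear F →
             ∀ i {X} → (∀ j → X i j ≈ 0#) → F X ≈ 0#
  zero-row {F = F} ml i {X} h = x+x≈x⇒x≈0 (F X) (begin
    F X + F X       ≈⟨ +-congʳ (*-identityˡ _) ⟨
    1# * F X + F X
      ≈⟨ linear ml i 1#
           (λ j → trans (h j) (sym (trans (+-cong (trans (*-congˡ (h j)) (zeroʳ _)) (h j)) (+-identityʳ _))))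
                         (λ _ _ _ → refl) (λ _ _ _ → refl) ⟨
    F X             ∎)

  linear-∑₀ : ∀ {m n} {F : Rows (suc m) n → Carrier} → Multilinear F →
                ∀ {l} (a : Fin l → Carrier) (u : Fin l → Fin n → Carrier) {w T} →
                (∀ j → w j ≈ ∑ (λ i → a i * u i j)) →
                F (w ∷ T) ≈ ∑ (λ i → a i * F (u i ∷ T))
  linear-∑₀ ml {zero}  a u eq = trans (zero-row ml zero λ j → trans (eq j) ∑-empty) (sym ∑-empty)
  linear-∑₀ ml {suc l} a u eq = trans (linear₀ ml (a zero) λ j → trans (eq j) (∑-suc _))
    (trans (+-congˡ (linear-∑₀ ml (a ∘ suc) (u ∘ suc) (λ _ → refl))) (sym (∑-suc _)))

  -- Linearity in one row at a time, the rows already treated being frozen by `fix-head`. The vector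
  -- `v` is not a row of `X`: in `det-unique` it is the first row of the matrix, which has been
  -- absorbed into `F`.
  add-multiples : ∀ {m n} {F : Rows m n → Carrier} → Multilinear F → ∀ (v : Fin n → Carrier) →
                  (∀ i {X} → (∀ j → X i j ≈ v j) → F X ≈ 0#) →
                  ∀ (a : Fin m → Carrier) {X Y} → (∀ i j → Y i j ≈ a i * v j + X i j) → F Y ≈ F X
  add-multiples {zero}  ml v vanish a eq = congruent ml λ ()
  add-multiples {suc m} {F = F} ml v vanish a {X} {Y} eq = begin
    F Y                                                     ≈⟨ congruent ml (∷-eta Y) ⟩
    F (Y zero ∷ tail Y)                                     ≈⟨ linear₀ ml (a zero) (eq zero) ⟩
    a zero * F (v ∷ tail Y) + F (X zero ∷ tail Y)
      ≈⟨ +-congʳ (trans (*-congˡ (vanish zero λ _ → refl)) (zeroʳ _)) ⟩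
    0# + F (X zero ∷ tail Y)                                ≈⟨ +-identityˡ _ ⟩
    F (X zero ∷ tail Y)
      ≈⟨ add-multiples (fix-head ml (X zero)) v (λ i → vanish (suc i)) (a ∘ suc) (eq ∘ suc) ⟩
    F (X zero ∷ tail X)                                     ≈⟨ congruent ml (∷-eta X) ⟨
    F X                                                     ∎

  record Alternating {m n} (F : Rows m n → Carrier) : Set (c ⊔ ℓ) where
    field
      multilinear : Multilinear F
      vanishes    : ∀ {i j X} → i ≢ j → (∀ k → X i k ≈ X j k) → F X ≈ 0#

  open Alternating

  -- Expand the value 0 at the rows u + v, u + v. Only vanishing on equal first two rows is assumed,
  -- since for `Det` the exchange is used on the way to the other pairs of rows.
  swap₀₁ : ∀ {m n} {F : Rows (suc (suc m)) n → Carrier} → Multilinear F →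
           (∀ {u v T} → (∀ k → u k ≈ v k) → F (u ∷ v ∷ T) ≈ 0#) →
           ∀ u v {T} → F (u ∷ v ∷ T) + F (v ∷ u ∷ T) ≈ 0#
  swap₀₁ {F = F} ml vanish u v {T} = begin
    F (u ∷ v ∷ T) + F (v ∷ u ∷ T)
      ≈⟨ +-cong (+-identityˡ _) (+-identityʳ _) ⟨
    (0# + F (u ∷ v ∷ T)) + (F (v ∷ u ∷ T) + 0#)
      ≈⟨ +-cong (+-cong (vanish λ _ → refl) (*-identityˡ _)) (+-cong (*-identityˡ _) (vanish λ _ → refl)) ⟨
    (F (u ∷ u ∷ T) + 1# * F (u ∷ v ∷ T)) + (1# * F (v ∷ u ∷ T) + F (v ∷ v ∷ T))
      ≈⟨ +-cong (trans (+-comm _ _) (sym (linear₀ (fix-head ml u) 1#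
                  λ _ → trans (+-comm _ _) (+-congʳ (sym (*-identityˡ _))))))
                (sym (linear₀ (fix-head ml v) 1# λ _ → +-congʳ (sym (*-identityˡ _)))) ⟩
    F (u ∷ w ∷ T) + F (v ∷ w ∷ T)
      ≈⟨ +-congʳ (*-identityˡ _) ⟨
    1# * F (u ∷ w ∷ T) + F (v ∷ w ∷ T)
      ≈⟨ linear₀ ml 1# (λ _ → +-congʳ (sym (*-identityˡ _))) ⟨
    F (w ∷ w ∷ T)
      ≈⟨ vanish (λ _ → refl) ⟩
    0# ∎
    where
    w : Fin _ → Carrier
    w j = u j + v j

  -- The Laplace expansion is multilinear and alternating

  sign : ℕ → Carrier
  sign n = (- 1#) ^ n

  σ : ∀ {n} → Fin n → Carrier
  σ j = sign (toℕ j)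

  minor : ∀ {n} → SquareMatrix (suc n) → Fin (suc n) → SquareMatrix n
  minor X j i k = X (suc i) (punchIn j k)

  opaque
    unfolding Det

    det-zero : ∀ {X : SquareMatrix 0} → Det X ≈ 1#
    det-zero = refl

    det-suc : ∀ {n} (X : SquareMatrix (suc n)) → Det X ≈ ∑ (λ j → σ j * X zero j * Det (minor X j))
    det-suc X = refl

    charPoly≈Det : ∀ {n} (A : SquareMatrix n) x → charPoly A x ≈ Det (λ i j → scalar n x i j - A i j)
    charPoly≈Det A x = refl

  det-cong : ∀ {n} {X Y : SquareMatrix n} → X ≋ Y → Det X ≈ Det Y
  det-cong {zero}          X≋Y = trans det-zero (sym det-zero)
  det-cong {suc n} {X} {Y} X≋Y = begin
    Det X                                     ≈⟨ det-suc X ⟩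
    ∑ (λ j → σ j * X zero j * Det (minor X j))
      ≈⟨ ∑-cong (λ j → *-cong (*-congˡ (X≋Y zero j)) (det-cong λ i k → X≋Y (suc i) (punchIn j k))) ⟩
    ∑ (λ j → σ j * Y zero j * Det (minor Y j))  ≈⟨ det-suc Y ⟨
    Det Y                                     ∎

  det-linear : ∀ n (i : Fin n) a {X Y Z : SquareMatrix n} → (∀ j → Z i j ≈ a * X i j + Y i j) →
               (∀ k → k ≢ i → ∀ j → X k j ≈ Z k j) → (∀ k → k ≢ i → ∀ j → Y k j ≈ Z k j) →
               Det Z ≈ a * Det X + Det Y
  det-linear (suc n) i a {X} {Y} {Z} eq X≈Z Y≈Z = begin
    Det Z
      ≈⟨ det-suc Z ⟩
    ∑ (λ j → σ j * Z zero j * Det (minor Z j))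
      ≈⟨ ∑-cong (λ j → term i eq X≈Z Y≈Z j) ⟩
    ∑ (λ j → a * (σ j * X zero j * Det (minor X j)) + σ j * Y zero j * Det (minor Y j))
      ≈⟨ ∑-linear a _ _ ⟩
    a * ∑ (λ j → σ j * X zero j * Det (minor X j)) + ∑ (λ j → σ j * Y zero j * Det (minor Y j))
      ≈⟨ +-cong (*-congˡ (det-suc X)) (det-suc Y) ⟨
    a * Det X + Det Y ∎
    where
    term : ∀ (i : Fin (suc n)) → (∀ j → Z i j ≈ a * X i j + Y i j) →
           (∀ k → k ≢ i → ∀ j → X k j ≈ Z k j) → (∀ k → k ≢ i → ∀ j → Y k j ≈ Z k j) →
           ∀ j → σ j * Z zero j * Det (minor Z j) ≈
                 a * (σ j * X zero j * Det (minor X j)) + σ j * Y zero j * Det (minor Y j)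
    term zero eq X≈Z Y≈Z j = begin
      σ j * Z zero j * Det (minor Z j)
        ≈⟨ *-congʳ (*-congˡ (eq j)) ⟩
      σ j * (a * X zero j + Y zero j) * Det (minor Z j)
        ≈⟨ solve 5 (λ s a x y d → s :* (a :* x :+ y) :* d := a :* (s :* x :* d) :+ s :* y :* d)
             refl (σ j) a (X zero j) (Y zero j) (Det (minor Z j)) ⟩
      a * (σ j * X zero j * Det (minor Z j)) + σ j * Y zero j * Det (minor Z j)
        ≈⟨ +-cong (*-congˡ (*-congˡ (det-cong λ i k → X≈Z (suc i) (λ ()) _)))
                  (*-congˡ (det-cong λ i k → Y≈Z (suc i) (λ ()) _)) ⟨
      a * (σ j * X zero j * Det (minor X j)) + σ j * Y zero j * Det (minor Y j) ∎
    term (suc i) eq X≈Z Y≈Z j = begin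
      σ j * Z zero j * Det (minor Z j)
        ≈⟨ *-congˡ (det-linear n i a (λ k → eq (punchIn j k))
             (λ k k≢i l → X≈Z (suc k) (k≢i ∘ Fin.suc-injective) (punchIn j l))
             (λ k k≢i l → Y≈Z (suc k) (k≢i ∘ Fin.suc-injective) (punchIn j l))) ⟩
      σ j * Z zero j * (a * Det (minor X j) + Det (minor Y j))
        ≈⟨ solve 5 (λ s z a x y → s :* z :* (a :* x :+ y) := a :* (s :* z :* x) :+ s :* z :* y)
             refl (σ j) (Z zero j) a (Det (minor X j)) (Det (minor Y j)) ⟩
      a * (σ j * Z zero j * Det (minor X j)) + σ j * Z zero j * Det (minor Y j)
        ≈⟨ +-cong (*-congˡ (*-congʳ (*-congˡ (X≈Z zero (λ ()) j)))) (*-congʳ (*-congˡ (Y≈Z zero (λ ()) j))) ⟨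
      a * (σ j * X zero j * Det (minor X j)) + σ j * Y zero j * Det (minor Y j) ∎

  det-multilinear : ∀ {n} → Multilinear (Det {n})
  det-multilinear {n} = record { congruent = det-cong ; linear = det-linear n }

  -- In the expansion of a determinant along two equal rows, the terms of
  -- the ordered column pairs (j , j′) and (j′ , j) cancel.
  mutual
    expansion₂-vanishes : ∀ n {a b : Fin (suc (suc n)) → Carrier} → (∀ j → a j ≈ b j) →
      (D : (Fin n → Fin (suc (suc n))) → Carrier) → (∀ {f g} → f ≗ g → D f ≈ D g) →
      ∑ (λ j → σ j * a j * ∑ (λ k → σ k * b (punchIn j k) * D (punchIn j ∘ punchIn k))) ≈ 0#
    expansion₂-vanishes n {a} {b} a≈b D D-cong = begin
      ∑ (λ j → σ j * a j * ∑ (λ k → σ k * b (punchIn j k) * D (punchIn j ∘ punchIn k)))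
        ≈⟨ ∑-suc _ ⟩
      1# * a zero * ∑ P + ∑ (λ j → - 1# * σ j * a (suc j) *
        ∑ (λ k → σ k * b (punchIn (suc j) k) * D (punchIn (suc j) ∘ punchIn k)))
        ≈⟨ +-cong (sym (∑-*ˡ _ _)) (∑-cong λ j → trans (*-congˡ (∑-suc _)) (distribˡ _ _ _)) ⟩
      ∑ (λ k → 1# * a zero * P k) + ∑ (λ j → U j + V j)
        ≈⟨ +-congˡ (∑-+ _ _) ⟩
      ∑ (λ k → 1# * a zero * P k) + (∑ U + ∑ V)
        ≈⟨ +-assoc _ _ _ ⟨
      ∑ (λ k → 1# * a zero * P k) + ∑ U + ∑ V
        ≈⟨ +-cong (trans (sym (∑-+ _ _)) (∑-zero cancel)) (expansion₂-tail n a≈b D D-cong) ⟩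
      0# + 0#
        ≈⟨ +-identityʳ _ ⟩
      0# ∎
      where
      -- `P` comes from choosing column 0 in the first row, `U` from choosing it in the second, `V`
      -- from choosing it in neither. `cancel` matches `P` with `U`, and `V` is left to
      -- `expansion₂-tail`.
      P : Fin (suc n) → Carrier
      P k = σ k * b (suc k) * D (suc ∘ punchIn k)
      Q : Fin (suc n) → Fin n → Carrier
      Q j k = - 1# * σ k * b (suc (punchIn j k)) * D (punchIn (suc j) ∘ punchIn (suc k))
      U V : Fin (suc n) → Carrier
      U j = - 1# * σ j * a (suc j) * (1# * b zero * D (suc ∘ punchIn j))
      V j = - 1# * σ j * a (suc j) * ∑ (Q j)

      cancel : ∀ k → 1# * a zero * P k + U k ≈ 0#
      cancel k = begin
        1# * a zero * P k + U k
          ≈⟨ +-cong (*-congʳ (*-congˡ (a≈b zero))) (*-congʳ (*-congˡ (a≈b (suc k)))) ⟩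
        1# * b zero * P k + - 1# * σ k * b (suc k) * (1# * b zero * D (suc ∘ punchIn k))
          ≈⟨ solve 5 (λ e s x y d → con 1 :* x :* (s :* y :* d) :+ e :* s :* y :* (con 1 :* x :* d)
                 := (con 1 :+ e) :* (s :* x :* y :* d))
               refl (- 1#) (σ k) (b zero) (b (suc k)) (D (suc ∘ punchIn k)) ⟩
        (1# + - 1#) * (σ k * b zero * b (suc k) * D (suc ∘ punchIn k))
          ≈⟨ trans (*-congʳ (-‿inverseʳ 1#)) (zeroˡ _) ⟩
        0# ∎

    expansion₂-tail : ∀ n {a b : Fin (suc (suc n)) → Carrier} → (∀ j → a j ≈ b j) →
      (D : (Fin n → Fin (suc (suc n))) → Carrier) → (∀ {f g} → f ≗ g → D f ≈ D g) →
      ∑ (λ j → - 1# * σ j * a (suc j) *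
        ∑ (λ k → - 1# * σ k * b (suc (punchIn j k)) * D (punchIn (suc j) ∘ punchIn (suc k)))) ≈ 0#
    expansion₂-tail zero    a≈b D D-cong = ∑-zero λ _ → trans (*-congˡ ∑-empty) (zeroʳ _)
    -- Column 0 now survives in every remaining minor, which `D′` records. Shifting both column
    -- indices by one contributes two factors -1, whose product is 1, so the sum is an instance of
    -- the previous lemma with one column less.
    expansion₂-tail (suc n) {a} {b} a≈b D D-cong = trans
      (∑-cong λ j → begin
        - 1# * σ j * a (suc j) * ∑ (λ k → - 1# * σ k * b (suc (punchIn j k)) * D (punchIn (suc j) ∘ punchIn (suc k)))
          ≈⟨ *-congˡ (∑-cong λ k → trans (trans (*-congʳ (*-assoc _ _ _)) (*-assoc _ _ _))
               (*-congˡ (*-congˡ (D-cong λ { zero → ≡.refl ; (suc l) → ≡.refl })))) ⟩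
        - 1# * σ j * a (suc j) * ∑ (λ k → - 1# * (σ k * b (suc (punchIn j k)) * D′ (punchIn j ∘ punchIn k)))
          ≈⟨ *-congˡ (∑-*ˡ (- 1#) _) ⟩
        - 1# * σ j * a (suc j) * (- 1# * S j)
          ≈⟨ solve 4 (λ e s x y → e :* s :* x :* (e :* y) := e :* e :* (s :* x :* y))
               refl (- 1#) (σ j) (a (suc j)) (S j) ⟩
        - 1# * - 1# * (σ j * a (suc j) * S j)
          ≈⟨ trans (*-congʳ (trans (-1*x≈-x _) (-‿involutive 1#))) (*-identityˡ _) ⟩
        σ j * a (suc j) * S j ∎)
      (expansion₂-vanishes n (a≈b ∘ suc) D′
        (λ f≗g → D-cong λ { zero → ≡.refl ; (suc l) → ≡.cong suc (f≗g l) }))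
      where
      D′ : (Fin n → Fin (suc (suc n))) → Carrier
      D′ f = D (zero ∷ suc ∘ f)
      S : Fin (suc (suc n)) → Carrier
      S j = ∑ (λ k → σ k * b (suc (punchIn j k)) * D′ (punchIn j ∘ punchIn k))

  det-tail-vanishes : ∀ {n} → (∀ {i j X} → i ≢ j → (∀ k → X i k ≈ X j k) → Det {n} X ≈ 0#) →
    ∀ {i j X} → i ≢ j → (∀ k → X (suc i) k ≈ X (suc j) k) → Det {suc n} X ≈ 0#
  det-tail-vanishes ih {X = X} i≢j eq = trans (det-suc X)
    (∑-zero λ l → trans (*-congˡ (ih i≢j (eq ∘ punchIn l))) (zeroʳ _))

  det-vanishes₀₁ : ∀ {n} {X : SquareMatrix (suc (suc n))} →
                   (∀ k → X zero k ≈ X (suc zero) k) → Det X ≈ 0#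
  det-vanishes₀₁ {n} {X} eq = begin
    Det X
      ≈⟨ det-suc X ⟩
    ∑ (λ j → σ j * X zero j * Det (minor X j))
      ≈⟨ ∑-cong (λ j → *-congˡ (det-suc (minor X j))) ⟩
    ∑ (λ j → σ j * X zero j * ∑ (λ k → σ k * X (suc zero) (punchIn j k) * D (punchIn j ∘ punchIn k)))
      ≈⟨ expansion₂-vanishes n eq D (λ f≗g → det-cong λ i k → reflexive (≡.cong (X (suc (suc i))) (f≗g k))) ⟩
    0# ∎
    where
    D : (Fin n → Fin (suc (suc n))) → Carrier
    D f = Det (λ i k → X (suc (suc i)) (f k))

  -- If the row equal to row 0 is not row 1, exchanging rows 0 and 1 moves both equal rows below the
  -- first, where the hypothesis on the minors applies.
  det-head-vanishes : ∀ {n} → (∀ {i j X} → i ≢ j → (∀ k → X i k ≈ X j k) → Det {n} X ≈ 0#) →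
    ∀ j {X} → (∀ k → X zero k ≈ X (suc j) k) → Det {suc n} X ≈ 0#
  det-head-vanishes ih zero eq = det-vanishes₀₁ eq
  det-head-vanishes ih (suc j) {X} eq = begin
    Det X
      ≈⟨ +-identityʳ _ ⟨
    Det X + 0#
      ≈⟨ +-cong (det-cong λ { zero k → refl ; (suc zero) k → refl ; (suc (suc i)) k → refl })
                (sym (det-tail-vanishes ih {i = zero} {j = suc j} (λ ()) eq)) ⟩
    Det (X zero ∷ X (suc zero) ∷ tail (tail X)) + Det (X (suc zero) ∷ X zero ∷ tail (tail X))
      ≈⟨ swap₀₁ det-multilinear det-vanishes₀₁ (X zero) (X (suc zero)) ⟩
    0# ∎

  det-vanishes : ∀ {n} {i j : Fin n} {X : SquareMatrix n} →
                 i ≢ j → (∀ k → X i k ≈ X j k) → Det X ≈ 0#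
  det-vanishes {i = zero}  {zero}  i≢j eq = contradiction ≡.refl i≢j
  det-vanishes {i = suc i} {suc j} i≢j eq = det-tail-vanishes det-vanishes (i≢j ∘ ≡.cong suc) eq
  det-vanishes {i = zero}  {suc j} i≢j eq = det-head-vanishes det-vanishes j eq
  det-vanishes {i = suc i} {zero}  i≢j eq = det-head-vanishes det-vanishes i (sym ∘ eq)

  -- Uniqueness of alternating functions, and multiplicativity of the determinant

  punchIn-cases : ∀ {p n} {P : Fin (suc n) → Set p} j → P j → (∀ l → P (punchIn j l)) → ∀ k → P k
  punchIn-cases {P = P} j Pj Pl k with j Fin.≟ k
  ... | yes ≡.refl = Pj
  ... | no j≢k     = ≡.subst P (Fin.punchIn-punchOut j≢k) (Pl _)

  insert0 : ∀ {n} → Fin (suc n) → (Fin n → Carrier) → Fin (suc n) → Carrier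
  insert0 j v = insertAt v j 0#

  insert0-≈ : ∀ {n} j {v : Fin n → Carrier} → insert0 j v j ≈ 0#
  insert0-≈ j {v} = reflexive (insertAt-lookup v j 0#)

  insert0-punchIn : ∀ {n} j {v : Fin n → Carrier} k → insert0 j v (punchIn j k) ≈ v k
  insert0-punchIn j {v} k = reflexive (insertAt-punchIn v j 0# k)

  insert0-cong : ∀ {n} j {u v : Fin n → Carrier} → (∀ k → u k ≈ v k) → ∀ k → insert0 j u k ≈ insert0 j v k
  insert0-cong j {u} {v} u≈v = punchIn-cases {P = λ k → insert0 j u k ≈ insert0 j v k} j
    (trans (insert0-≈ j {u}) (sym (insert0-≈ j {v})))
    (λ l → trans (insert0-punchIn j l) (trans (u≈v l) (sym (insert0-punchIn j l))))

  insert0-linear : ∀ {n} j a {u v w : Fin n → Carrier} → (∀ k → w k ≈ a * u k + v k) →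
                   ∀ k → insert0 j w k ≈ a * insert0 j u k + insert0 j v k
  insert0-linear j a {u} {v} {w} eq = punchIn-cases
    {P = λ k → insert0 j w k ≈ a * insert0 j u k + insert0 j v k} j
    (trans (insert0-≈ j {w}) (sym (trans
      (+-cong (trans (*-congˡ (insert0-≈ j {u})) (zeroʳ a)) (insert0-≈ j {v})) (+-identityʳ _))))
    (λ l → trans (insert0-punchIn j l) (trans (eq l)
      (sym (+-cong (*-congˡ (insert0-punchIn j l)) (insert0-punchIn j l)))))

  border : ∀ {n} → Fin (suc n) → SquareMatrix n → SquareMatrix (suc n)
  border {n} j Z = identity (suc n) j ∷ λ i → insert0 j (Z i)

  -- Freezing the border turns an alternating function of one size into one of the next smaller
  -- size; this drives the inductions of `border-sign` and `det-unique`.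
  border-alternating : ∀ {n} {F : SquareMatrix (suc n) → Carrier} → Alternating F →
                       ∀ j → Alternating (F ∘ border j)
  border-alternating {F = F} alt j = record
    { multilinear = record
      { congruent = λ X≋Y → congruent ml λ i → insert0-cong j (X≋Y i)
      ; linear    = λ i a eq X≈Z Y≈Z → linear ml i a (insert0-linear j a eq)
          (λ k k≢i → insert0-cong j (X≈Z k k≢i)) (λ k k≢i → insert0-cong j (Y≈Z k k≢i))
      }
    ; vanishes = λ {i} {k} i≢k eq → vanishes alt {suc i} {suc k} (i≢k ∘ Fin.suc-injective) (insert0-cong j eq)
    }
    where
    ml = fix-head (multilinear alt) (identity _ j)

  border-identity₀ : ∀ {n} → border zero (identity n) ≋ identity (suc n)
  border-identity₀ zero    k       = refl
  border-identity₀ (suc i) zero    = refl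
  border-identity₀ (suc i) (suc k) = refl

  -- `border j (identity n)` is the permutation matrix of a cycle of length j + 1. Exchanging its
  -- first two rows puts `e zero` on top, and below it stands a cycle of length j.
  border-sign : ∀ {n} {F : SquareMatrix (suc n) → Carrier} → Alternating F →
                ∀ j → F (border j (identity n)) ≈ σ j * F (identity (suc n))
  border-sign alt zero = trans (congruent (multilinear alt) border-identity₀) (sym (*-identityˡ _))
  border-sign {suc n} {F} alt (suc j) = begin
    F (border (suc j) (identity (suc n)))
      ≈⟨ congruent ml rows ⟩
    F (e (suc j) ∷ e zero ∷ T)
      ≈⟨ +-inverseˡ-unique _ _ (swap₀₁ ml (vanishes alt {zero} {suc zero} λ ()) (e (suc j)) (e zero)) ⟩
    - F (e zero ∷ e (suc j) ∷ T)
      ≈⟨ -‿cong (congruent ml rows′) ⟩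
    - F (border zero (border j (identity n)))
      ≈⟨ -‿cong (border-sign (border-alternating alt zero) j) ⟩
    - (σ j * F (border zero (identity (suc n))))
      ≈⟨ -‿cong (*-congˡ (congruent ml border-identity₀)) ⟩
    - (σ j * F (identity (suc (suc n))))
      ≈⟨ -1*x≈-x _ ⟨
    - 1# * (σ j * F (identity (suc (suc n))))
      ≈⟨ *-assoc _ _ _ ⟨
    - 1# * σ j * F (identity (suc (suc n))) ∎
    where
    ml = multilinear alt
    e = identity (suc (suc n))
    T : Rows n (suc (suc n))
    T i = insert0 zero (insert0 j (identity n i))

    zeros : ∀ k → insert0 j (λ _ → 0#) k ≈ 0#
    zeros = punchIn-cases {P = λ k → insert0 j (λ _ → 0#) k ≈ 0#} j
      (insert0-≈ j {λ _ → 0#}) (λ l → insert0-punchIn j l)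

    rows : border (suc j) (identity (suc n)) ≋ e (suc j) ∷ e zero ∷ T
    rows zero          k       = refl
    rows (suc zero)    zero    = refl
    rows (suc zero)    (suc k) = zeros k
    rows (suc (suc i)) zero    = refl
    rows (suc (suc i)) (suc k) = refl

    rows′ : e zero ∷ e (suc j) ∷ T ≋ border zero (border j (identity n))
    rows′ zero          k       = refl
    rows′ (suc zero)    zero    = refl
    rows′ (suc zero)    (suc k) = refl
    rows′ (suc (suc i)) k       = refl

  -- Expand the first row in the standard basis and clear column j below a first row e j by row
  -- operations; what remains is an alternating function of the minor.
  det-unique : ∀ {n} {F : SquareMatrix n → Carrier} → Alternating F → ∀ X → F X ≈ Det X * F (identity n)
  det-unique {zero}  {F} alt X = begin
    F X                    ≈⟨ congruent (multilinear alt) (λ ()) ⟩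
    F (identity 0)         ≈⟨ *-identityˡ _ ⟨
    1# * F (identity 0)    ≈⟨ *-congʳ det-zero ⟨
    Det X * F (identity 0) ∎
  det-unique {suc n} {F} alt X = begin
    F X
      ≈⟨ congruent ml (∷-eta X) ⟩
    F (X zero ∷ tail X)
      ≈⟨ linear-∑₀ ml (X zero) e (λ k → sym (trans (∑-scalarʳ 1# (X zero) k) (*-identityʳ _))) ⟩
    ∑ (λ j → X zero j * F (e j ∷ tail X))
      ≈⟨ ∑-cong (λ j → *-congˡ (clear j)) ⟩
    ∑ (λ j → X zero j * F (border j (minor X j)))
      ≈⟨ ∑-cong (λ j → *-congˡ (det-unique (border-alternating alt j) (minor X j))) ⟩
    ∑ (λ j → X zero j * (Det (minor X j) * F (border j (identity n))))
      ≈⟨ ∑-cong (λ j → trans (*-congˡ (*-congˡ (border-sign alt j)))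
           (rearrange (X zero j) (Det (minor X j)) (σ j))) ⟩
    ∑ (λ j → σ j * X zero j * Det (minor X j) * F e)
      ≈⟨ ∑-*ʳ (F e) _ ⟩
    ∑ (λ j → σ j * X zero j * Det (minor X j)) * F e
      ≈⟨ *-congʳ (det-suc X) ⟨
    Det X * F e ∎
    where
    ml = multilinear alt
    e = identity (suc n)

    rearrange : ∀ x d s → x * (d * (s * F e)) ≈ s * x * d * F e
    rearrange x d s = solve 4 (λ x d s f → x :* (d :* (s :* f)) := s :* x :* d :* f) refl x d s (F e)

    clear : ∀ j → F (e j ∷ tail X) ≈ F (border j (minor X j))
    clear j = add-multiples (fix-head ml (e j)) (e j)
      (λ i eq → vanishes alt {zero} {suc i} (λ ()) (sym ∘ eq))
      (λ i → X (suc i) j)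
      (λ i → punchIn-cases {P = λ k → X (suc i) k ≈ X (suc i) j * e j k + insert0 j (minor X j i) k} j
        (sym (trans
          (+-cong (trans (*-congˡ (scalar-diagonal 1# j)) (*-identityʳ _)) (insert0-≈ j {minor X j i}))
          (+-identityʳ _)))
        (λ l → sym (trans
          (+-cong (trans (*-congˡ (scalar-off-diagonal 1# (Fin.punchInᵢ≢i j l ∘ ≡.sym))) (zeroʳ _))
                  (insert0-punchIn j l))
          (+-identityˡ _))))

  infixl 7 _·_
  _·_ : ∀ {n} → SquareMatrix n → SquareMatrix n → SquareMatrix n
  (X · Y) i j = ∑ (λ l → X i l * Y l j)

  ·-alternating : ∀ {n} (Y : SquareMatrix n) → Alternating (λ X → Det (X · Y))
  ·-alternating Y = record
    { multilinear = record
      { congruent = λ X≋X′ → det-cong λ i j → ∑-cong λ l → *-congʳ (X≋X′ i l)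
      ; linear    = λ i a eq X≈Z Y≈Z → det-linear _ i a
          (λ j → trans
            (∑-cong λ l → trans (*-congʳ (eq l)) (trans (distribʳ _ _ _) (+-congʳ (*-assoc _ _ _))))
            (∑-linear a _ _))
          (λ k k≢i j → ∑-cong λ l → *-congʳ (X≈Z k k≢i l))
          (λ k k≢i j → ∑-cong λ l → *-congʳ (Y≈Z k k≢i l))
      }
    ; vanishes = λ i≢j eq → det-vanishes i≢j λ k → ∑-cong λ l → *-congʳ (eq l)
    }

  -- For fixed `Y` the left side is alternating in `X`, so `det-unique` reduces it to its value at
  -- the identity matrix.
  det-· : ∀ {n} (X Y : SquareMatrix n) → Det (X · Y) ≈ Det X * Det Y
  det-· {n} X Y = trans (det-unique (·-alternating Y) X)
    (*-congˡ (det-cong λ i j → trans (∑-scalarˡ 1# i (λ l → Y l j)) (*-identityˡ _)))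

  det-neg : ∀ {n} (X : SquareMatrix n) → Det (λ i j → - X i j) ≈ sign n * Det X
  det-neg {zero}  X = trans det-zero (sym (trans (*-identityˡ _) det-zero))
  det-neg {suc n} X = begin
    Det (λ i j → - X i j)
      ≈⟨ det-suc _ ⟩
    ∑ (λ j → σ j * - X zero j * Det (λ i k → - minor X j i k))
      ≈⟨ ∑-cong (λ j → trans (*-cong (*-congˡ (sym (-1*x≈-x _))) (det-neg (minor X j)))
           (solve 5 (λ s e x f d → s :* (e :* x) :* (f :* d) := e :* f :* (s :* x :* d))
                refl (σ j) (- 1#) (X zero j) (sign n) (Det (minor X j)))) ⟩
    ∑ (λ j → - 1# * sign n * (σ j * X zero j * Det (minor X j)))
      ≈⟨ ∑-*ˡ _ _ ⟩
    - 1# * sign n * ∑ (λ j → σ j * X zero j * Det (minor X j))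
      ≈⟨ *-congˡ (det-suc X) ⟨
    - 1# * sign n * Det X ∎

  charPoly-cong : ∀ {n} {A B : SquareMatrix n} → A ≋ B → ∀ x → charPoly A x ≈ charPoly B x
  charPoly-cong {A = A} {B} A≋B x = trans (charPoly≈Det A x)
    (trans (det-cong λ i j → +-congˡ (-‿cong (A≋B i j))) (sym (charPoly≈Det B x)))

-- Transfer along permutations of roots and along ring homomorphisms

module _ {c ℓ} (R : CommutativeRing c ℓ) where
  open CommutativeRing R
  open import Data.List.Relation.Binary.Permutation.Setoid.Properties setoid using (foldr-commMonoid; map⁺)
  open import Data.List.Relation.Binary.Permutation.Setoid setoid using (_↭_)

  product-↭ : ∀ x {Λ M} → Λ ↭ M →
    foldr _*_ 1# (map (λ μ → x - μ) Λ) ≈ foldr _*_ 1# (map (λ μ → x - μ) M)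
  product-↭ x Λ↭M = foldr-commMonoid *-isCommutativeMonoid (map⁺ setoid (λ eq → +-congˡ (-‿cong eq)) Λ↭M)

module _ {c₁ ℓ₁ c₂ ℓ₂} (R : CommutativeRing c₁ ℓ₁) (S : CommutativeRing c₂ ℓ₂) where
  private
    module R = CommutativeRing R
    module S = CommutativeRing S
    module RD = Determinants R
    module SD = Determinants S
  open RingMorphisms R.rawRing S.rawRing

  module _ {φ : R.Carrier → S.Carrier} (hom : IsRingHomomorphism φ) where
    open IsRingHomomorphism hom

    ∑-homo : ∀ {n} (f : Fin n → R.Carrier) → φ (RD.∑ f) S.≈ SD.∑ (λ i → φ (f i))
    ∑-homo {zero}  f = S.trans (⟦⟧-cong RD.∑-empty) (S.trans 0#-homo (S.sym SD.∑-empty))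
    ∑-homo {suc n} f = S.trans (⟦⟧-cong (RD.∑-suc f)) (S.trans (+-homo _ _)
      (S.trans (S.+-congˡ (∑-homo (f ∘ suc))) (S.sym (SD.∑-suc _))))

    sign-homo : ∀ n → φ (RD.sign n) S.≈ SD.sign n
    sign-homo zero    = 1#-homo
    sign-homo (suc n) = S.trans (*-homo _ _)
      (S.*-cong (S.trans (-‿homo _) (S.-‿cong 1#-homo)) (sign-homo n))

    det-homo : ∀ {n} (X : RD.Rows n n) → φ (RD.Det X) S.≈ SD.Det (λ i j → φ (X i j))
    det-homo {zero}  X = S.trans (⟦⟧-cong RD.det-zero) (S.trans 1#-homo (S.sym SD.det-zero))
    det-homo {suc n} X = S.trans (⟦⟧-cong (RD.det-suc X)) (S.trans (∑-homo _) (S.trans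
      (SD.∑-cong λ j → S.trans (*-homo _ _) (S.*-cong
        (S.trans (*-homo _ _) (S.*-congʳ (sign-homo (toℕ j)))) (det-homo (RD.minor X j))))
      (S.sym (SD.det-suc _))))

    if-homo : ∀ b x → φ (if b then x else R.0#) S.≈ (if b then φ x else S.0#)
    if-homo true  x = S.refl
    if-homo false x = 0#-homo

    charPoly-homo : ∀ {n} (A : RD.Rows n n) x →
      φ (Matrices.charPoly R A x) S.≈ Matrices.charPoly S (λ i j → φ (A i j)) (φ x)
    charPoly-homo A x = S.trans (⟦⟧-cong (RD.charPoly≈Det A x)) (S.trans (det-homo _) (S.trans
      (SD.det-cong λ i j → S.trans (+-homo _ _) (S.+-cong (if-homo (does (i Fin.≟ j)) x) (-‿homo _)))
      (S.sym (SD.charPoly≈Det _ _))))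

-- Characteristic polynomials of integer matrices

open import Data.Integer.Base using (ℤ; 0ℤ; 1ℤ; -1ℤ; _+_; _*_; -_; _-_; _≤_; ∣_∣)
open import Data.Nat.Base using (_^_)
open ≡ using (refl; sym; trans; cong; cong₂; subst; subst₂; module ≡-Reasoning)
open Matrices ℤ.+-*-commutativeRing using (SquareMatrix; scalar; charPoly)
open Determinants ℤ.+-*-commutativeRing

-- f is a polynomial function of degree less than d, in Horner form.
data Polynomial : ℕ → (ℤ → ℤ) → Set where
  nil  : ∀ {f} → (∀ x → f x ≡ 0ℤ) → Polynomial 0 f
  cons : ∀ {d f} a g → Polynomial d g → (∀ x → f x ≡ a + x * g x) → Polynomial (suc d) f

poly-resp : ∀ {d f g} → (∀ x → g x ≡ f x) → Polynomial d f → Polynomial d g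
poly-resp eq (nil f≡0)       = nil λ x → trans (eq x) (f≡0 x)
poly-resp eq (cons a g p f≡) = cons a g p λ x → trans (eq x) (f≡ x)

poly-0 : ∀ {d} → Polynomial d (λ _ → 0ℤ)
poly-0 {zero}  = nil λ _ → refl
poly-0 {suc d} = cons 0ℤ _ poly-0 λ x → sym (trans (ℤ.+-identityˡ _) (ℤ.*-zeroʳ x))

poly-+ : ∀ {d f g} → Polynomial d f → Polynomial d g → Polynomial d (λ x → f x + g x)
poly-+ (nil f≡0) (nil g≡0) = nil λ x → cong₂ _+_ (f≡0 x) (g≡0 x)
poly-+ (cons a f p f≡) (cons b g q g≡) = cons (a + b) _ (poly-+ p q) λ x →
  trans (cong₂ _+_ (f≡ x) (g≡ x))
    (solve 5 (λ a b x f g → a :+ x :* f :+ (b :+ x :* g) := a :+ b :+ x :* (f :+ g)) refl a b x (f x) (g x))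
  where open +-*-Solver

poly-* : ∀ {d f} c → Polynomial d f → Polynomial d (λ x → c * f x)
poly-* c (nil f≡0) = nil λ x → trans (cong (c *_) (f≡0 x)) (ℤ.*-zeroʳ c)
poly-* c (cons a g p f≡) = cons (c * a) _ (poly-* c p) λ x → trans (cong (c *_) (f≡ x))
  (solve 4 (λ c a x g → c :* (a :+ x :* g) := c :* a :+ x :* (c :* g)) refl c a x (g x))
  where open +-*-Solver

poly-- : ∀ {d f g} → Polynomial d f → Polynomial d g → Polynomial d (λ x → f x - g x)
poly-- {f = f} {g} p q = poly-resp (λ x → cong (f x +_) (sym (ℤ.-1*i≡-i (g x)))) (poly-+ p (poly-* -1ℤ q))

poly-weaken : ∀ {d e f} → d ℕ.≤ e → Polynomial d f → Polynomial e f
poly-weaken ℕ.z≤n       (nil f≡0)       = poly-resp f≡0 poly-0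
poly-weaken (ℕ.s≤s d≤e) (cons a g p f≡) = cons a g (poly-weaken d≤e p) f≡

poly-x* : ∀ {d f} → Polynomial d f → Polynomial (suc d) (λ x → x * f x)
poly-x* p = cons 0ℤ _ p λ x → sym (ℤ.+-identityˡ _)

poly-^ : ∀ d → Polynomial (suc d) (λ x → x ℤ.^ d)
poly-^ zero    = cons 1ℤ _ (nil λ _ → refl) λ x → sym (cong (1ℤ +_) (ℤ.*-zeroʳ x))
poly-^ (suc d) = poly-x* (poly-^ d)

poly-affine : ∀ {d f} a b → Polynomial d f → Polynomial (suc d) (λ x → (a + b * x) * f x)
poly-affine {f = f} a b p = poly-resp
  (λ x → solve 4 (λ a b x f → (a :+ b :* x) :* f := a :* f :+ b :* (x :* f)) refl a b x (f x))
  (poly-+ (poly-weaken (ℕ.n≤1+n _) (poly-* a p)) (poly-* b (poly-x* p)))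
  where open +-*-Solver

poly-∑ : ∀ {d n} {f : Fin n → ℤ → ℤ} → (∀ j → Polynomial d (f j)) → Polynomial d (λ x → ∑ (λ j → f j x))
poly-∑ {n = zero}  p = poly-resp (λ _ → ∑-empty) poly-0
poly-∑ {n = suc n} p = poly-resp (λ _ → ∑-suc _) (poly-+ (p zero) (poly-∑ (p ∘ suc)))

-- Stands in for "at infinitely many points". Zeros of arbitrarily large absolute value let
-- coefficients be killed by size alone, so that no roots have to be counted.
Unbounded : (ℤ → Set) → Set
Unbounded P = ∀ N → ∃[ x ] N ℕ.< ∣ x ∣ × P x

-- An integer a = - x h with ∣x∣ > ∣a∣ is zero, and then so is h.
horner-step : ∀ a {h : ℤ → ℤ} → Unbounded (λ x → a + x * h x ≡ 0ℤ) →
              a ≡ 0ℤ × Unbounded (λ x → h x ≡ 0ℤ)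
horner-step a {h} zeros = a≡0 , λ N → let x , N<x , eq = zeros N in x , N<x , h≡0 x N<x eq
  where
  ∣a∣≡ : ∀ x → a + x * h x ≡ 0ℤ → ∣ a ∣ ≡ ∣ x ∣ ℕ.* ∣ h x ∣
  ∣a∣≡ x eq = trans (cong ∣_∣ (ℤ.i-j≡0⇒i≡j a (- (x * h x)) (trans (cong (a +_) (ℤ.neg-involutive _)) eq)))
    (trans (ℤ.∣-i∣≡∣i∣ (x * h x)) (ℤ.abs-* x (h x)))

  a≡0 : a ≡ 0ℤ
  a≡0 with x , a<x , eq ← zeros ∣ a ∣ with ∣ h x ∣ | ∣a∣≡ x eq
  ... | zero  | e = ℤ.∣i∣≡0⇒i≡0 (trans e (ℕ.*-zeroʳ ∣ x ∣))
  ... | suc k | e = contradiction (subst (∣ x ∣ ℕ.≤_) (sym e) (ℕ.m≤m*n ∣ x ∣ (suc k))) (ℕ.<⇒≱ a<x)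

  h≡0 : ∀ {N} x → N ℕ.< ∣ x ∣ → a + x * h x ≡ 0ℤ → h x ≡ 0ℤ
  h≡0 {N} x N<x eq = ℤ.∣i∣≡0⇒i≡0 (ℕ.m*n≡0⇒m≡0 ∣ h x ∣ ∣ x ∣ {{ℕ.>-nonZero (ℕ.≤-<-trans ℕ.z≤n N<x)}}
    (trans (ℕ.*-comm ∣ h x ∣ ∣ x ∣) (trans (sym (∣a∣≡ x eq)) (cong ∣_∣ a≡0))))

poly-vanishes : ∀ {d f} → Polynomial d f → Unbounded (λ x → f x ≡ 0ℤ) → ∀ x → f x ≡ 0ℤ
poly-vanishes (nil f≡0) zeros x = f≡0 x
poly-vanishes (cons a g p f≡) zeros x =
  let a≡0 , zeros′ = horner-step a λ N → let y , N<y , eq = zeros N in y , N<y , trans (sym (f≡ y)) eq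
  in trans (f≡ x) (trans (cong₂ (λ u v → u + x * v) a≡0 (poly-vanishes p zeros′ x))
       (trans (ℤ.+-identityˡ _) (ℤ.*-zeroʳ x)))

-- Each Horner step removes a constant term of `f` and one power of x, until only c remains.
poly-leading : ∀ {d f} c → Polynomial d f → Unbounded (λ x → c * x ℤ.^ d + f x ≡ 0ℤ) → c ≡ 0ℤ
poly-leading c (nil f≡0) zeros = let x , _ , eq = zeros 0 in
  trans (sym (trans (cong (c * 1ℤ +_) (f≡0 x)) (trans (ℤ.+-identityʳ _) (ℤ.*-identityʳ c)))) eq
poly-leading {suc d} c (cons a g p f≡) zeros = poly-leading c p (proj₂ (horner-step a λ N →
  let x , N<x , eq = zeros N in x , N<x , trans (sym (rearrange x)) eq))
  where
  open +-*-Solver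
  rearrange : ∀ x → c * x ℤ.^ suc d + _ ≡ a + x * (c * x ℤ.^ d + g x)
  rearrange x = trans (cong (c * x ℤ.^ suc d +_) (f≡ x))
    (solve 5 (λ a c x y g → c :* (x :* y) :+ (a :+ x :* g) := a :+ x :* (c :* y :+ g))
         refl a c x (x ℤ.^ d) (g x))

-- Determinants of matrices with affine entries

pencil : ∀ {n} → SquareMatrix n → SquareMatrix n → ℤ → SquareMatrix n
pencil C E x i j = C i j + E i j * x

term-pencil : ∀ {d n} (C E : SquareMatrix (suc n)) j →
              Polynomial d (λ x → Det (pencil (minor C j) (minor E j) x)) →
              Polynomial (suc d) (λ x → σ j * pencil C E x zero j * Det (minor (pencil C E x) j))
term-pencil C E j p = poly-resp
  (λ x → ℤ.*-assoc (σ j) (pencil C E x zero j) (Det (minor (pencil C E x) j)))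
  (poly-* (σ j) (poly-affine (C zero j) (E zero j) p))

det-pencil : ∀ {n} (C E : SquareMatrix n) → Polynomial (suc n) (λ x → Det (pencil C E x))
det-pencil {zero}  C E = poly-resp (λ x → det-zero) (poly-^ 0)
det-pencil {suc n} C E = poly-resp (λ x → det-suc _)
  (poly-∑ λ j → term-pencil C E j (det-pencil (minor C j) (minor E j)))

-- A row free of x costs one degree. Such a row occurs in the minors of xI - M at row 0 and column j
-- + 1: deleting the column removes the only x of row j + 1.
det-pencil-constant-row : ∀ {n} (C E : SquareMatrix n) i → (∀ j → E i j ≡ 0ℤ) →
                          Polynomial n (λ x → Det (pencil C E x))
det-pencil-constant-row {suc n} C E zero E≡0 = poly-resp (λ x → det-suc _) (poly-∑ λ j →
  poly-resp (λ x → cong (λ e → σ j * e * Det (minor (pencil C E x) j))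
      (trans (cong (λ e → C zero j + e * x) (E≡0 j)) (ℤ.+-identityʳ _)))
    (poly-* (σ j * C zero j) (det-pencil (minor C j) (minor E j))))
det-pencil-constant-row {suc n} C E (suc i) E≡0 = poly-resp (λ x → det-suc _) (poly-∑ λ j →
  term-pencil C E j (det-pencil-constant-row (minor C j) (minor E j) i (E≡0 ∘ punchIn j)))

-- The two leading coefficients of the characteristic polynomial

χ : ∀ {n} → SquareMatrix n → ℤ → ℤ
χ {n} M x = Det (λ i j → scalar n x i j - M i j)

trace : ∀ {n} → SquareMatrix n → ℤ
trace M = ∑ λ i → M i i

scalar-* : ∀ {n} x (i j : Fin n) → scalar n x i j ≡ identity n i j * x
scalar-* x i j with i Fin.≟ j
... | yes _ = sym (ℤ.*-identityˡ x)
... | no _  = refl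

χ-pencil : ∀ {n} (M : SquareMatrix n) x → χ M x ≡ Det (pencil (λ i j → - M i j) (identity n) x)
χ-pencil M x = det-cong λ i j → trans (ℤ.+-comm _ (- M i j)) (cong (- M i j +_) (scalar-* x i j))

χ-polynomial : ∀ {n} (M : SquareMatrix n) → Polynomial (suc n) (χ M)
χ-polynomial M = poly-resp (χ-pencil M) (det-pencil (λ i j → - M i j) (identity _))

-- In the expansion along the first row the off-diagonal terms have degree below n, so the two
-- leading coefficients come from (x - M₀₀) times the characteristic polynomial of the corner minor,
-- and the trace accumulates by induction.
χ-expansion : ∀ {n} (M : SquareMatrix (suc n)) →
              ∃[ f ] Polynomial n f × (∀ x → χ M x ≡ x ℤ.^ suc n - trace M * x ℤ.^ n + f x)
χ-expansion {n} M = f n M , f-poly n M , f-eq n M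
  where
  offDiagonal : ∀ n → SquareMatrix (suc n) → ℤ → ℤ
  offDiagonal n M x = ∑ λ j → σ (suc j) * (0ℤ - M zero (suc j)) *
    Det (minor (λ i k → scalar (suc n) x i k - M i k) (suc j))

  offDiagonal-poly : ∀ n M → Polynomial n (offDiagonal n M)
  offDiagonal-poly n M = poly-∑ λ j → poly-* (σ (suc j) * (0ℤ - M zero (suc j)))
    (poly-resp
      (λ x → det-cong λ i k → let y = - M (suc i) (punchIn (suc j) k) in
        trans (ℤ.+-comm _ y) (cong (y +_) (scalar-* x (suc i) (punchIn (suc j) k))))
      (det-pencil-constant-row (minor (λ i k → - M i k) (suc j)) (minor (identity (suc n)) (suc j)) j
        λ k → scalar-off-diagonal 1ℤ (Fin.punchInᵢ≢i (suc j) k ∘ sym)))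

  f : ∀ n → SquareMatrix (suc n) → ℤ → ℤ
  f zero    M x = 0ℤ
  -- What is left of (x - a) (xⁿ⁺¹ - t xⁿ + g) once xⁿ⁺² and (a + t) xⁿ⁺¹ are taken out, with a the
  -- corner entry and t the trace of the minor.
  f (suc n) M x = M zero zero * trace (minor M zero) * x ℤ.^ n + (- M zero zero + 1ℤ * x) * f n (minor M zero) x
                  + offDiagonal (suc n) M x

  f-poly : ∀ n M → Polynomial n (f n M)
  f-poly zero    M = poly-0
  f-poly (suc n) M = poly-+
    (poly-+ (poly-* (M zero zero * trace (minor M zero)) (poly-^ n))
            (poly-affine (- M zero zero) 1ℤ (f-poly n (minor M zero))))
    (offDiagonal-poly (suc n) M)

  expand : ∀ n M x → χ M x ≡ (x - M zero zero) * χ (minor M zero) x + offDiagonal n M x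
  expand n M x = trans (det-suc _) (trans (∑-suc _)
    (cong (λ e → e * χ (minor M zero) x + offDiagonal n M x) (ℤ.*-identityˡ (x - M zero zero))))

  f-eq : ∀ n M x → χ M x ≡ x ℤ.^ suc n - trace M * x ℤ.^ n + f n M x
  f-eq zero M x = begin
    χ M x                                                        ≡⟨ expand 0 M x ⟩
    (x - M zero zero) * χ (minor M zero) x + offDiagonal 0 M x
      ≡⟨ cong₂ (λ u v → (x - M zero zero) * u + v) det-zero ∑-empty ⟩
    (x - M zero zero) * 1ℤ + 0ℤ
      ≡⟨ solve 2 (λ x a → (x :- a) :* con 1ℤ :+ con 0ℤ := x :* con 1ℤ :- (a :+ con 0ℤ) :* con 1ℤ :+ con 0ℤ)
           refl x (M zero zero) ⟩
    x * 1ℤ - (M zero zero + 0ℤ) * 1ℤ + 0ℤ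
      ≡⟨ cong (λ t → x * 1ℤ - t * 1ℤ + 0ℤ) (trans (∑-suc _) (cong (M zero zero +_) ∑-empty)) ⟨
    x * 1ℤ - trace M * 1ℤ + 0ℤ                                   ∎
    where
    open ≡-Reasoning
    open +-*-Solver
  f-eq (suc n) M x = begin
    χ M x
      ≡⟨ expand (suc n) M x ⟩
    (x - a) * χ (minor M zero) x + o
      ≡⟨ cong (λ e → (x - a) * e + o) (f-eq n (minor M zero) x) ⟩
    (x - a) * (x * x ℤ.^ n - t * x ℤ.^ n + g) + o
      ≡⟨ solve 6 (λ x y a t g o → (x :- a) :* (x :* y :- t :* y :+ g) :+ o
             := x :* (x :* y) :- (a :+ t) :* (x :* y) :+ (a :* t :* y :+ (:- a :+ con 1ℤ :* x) :* g :+ o))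
           refl x (x ℤ.^ n) a t g o ⟩
    x * (x * x ℤ.^ n) - (a + t) * (x * x ℤ.^ n) + f (suc n) M x
      ≡⟨ cong (λ e → x * (x * x ℤ.^ n) - e * (x * x ℤ.^ n) + f (suc n) M x) (∑-suc _) ⟨
    x ℤ.^ suc (suc n) - trace M * x ℤ.^ suc n + f (suc n) M x ∎
    where
    open ≡-Reasoning
    open +-*-Solver
    a = M zero zero
    t = trace (minor M zero)
    g = f n (minor M zero) x
    o = offDiagonal (suc n) M x

χ-monic : ∀ {n} (M : SquareMatrix n) → ∃[ f ] Polynomial n f × (∀ x → χ M x ≡ x ℤ.^ n + f x)
χ-monic {zero}  M = (λ _ → 0ℤ) , poly-0 , λ x → det-zero
χ-monic {suc n} M = let f , p , eq = χ-expansion M in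
  (λ x → - trace M * x ℤ.^ n + f x) , poly-+ (poly-* (- trace M) (poly-^ n)) (poly-weaken (ℕ.n≤1+n n) p) ,
  λ x → trans (eq x) (trans (ℤ.+-assoc (x ℤ.^ suc n) _ _)
    (cong (λ e → x ℤ.^ suc n + (e + f x)) (ℤ.neg-distribˡ-* (trace M) (x ℤ.^ n))))

always : ∀ {P : ℤ → Set} → (∀ x → P x) → Unbounded P
always p N = ℤ.+ suc N , ℕ.≤-refl , p _

-- Otherwise the difference of the two polynomials would have leading coefficient 1 in degree n and
-- yet vanish everywhere.
χ-order≮ : ∀ {m n} (A : SquareMatrix m) (B : SquareMatrix n) → (∀ x → χ A x ≡ χ B x) → ¬ (m ℕ.< n)
χ-order≮ {m} {n} A B eq m<n with f , p , B≡ ← χ-monic B =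
  contradiction (poly-leading 1ℤ (poly-- p (poly-weaken m<n (χ-polynomial A))) (always λ x → begin
    1ℤ * x ℤ.^ n + (f x - χ A x)
      ≡⟨ solve 3 (λ y f a → con 1ℤ :* y :+ (f :- a) := y :+ f :- a) refl (x ℤ.^ n) (f x) (χ A x) ⟩
    x ℤ.^ n + f x - χ A x               ≡⟨ cong₂ _-_ (sym (B≡ x)) (eq x) ⟩
    χ B x - χ B x                     ≡⟨ ℤ.+-inverseʳ (χ B x) ⟩
    0ℤ                                ∎)) λ ()
  where
  open ≡-Reasoning
  open +-*-Solver

χ-order : ∀ {m n} (A : SquareMatrix m) (B : SquareMatrix n) → (∀ x → χ A x ≡ χ B x) → m ≡ n
χ-order {m} {n} A B eq with ℕ.<-cmp m n
... | tri< m<n _ _ = contradiction m<n (χ-order≮ A B eq)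
... | tri≈ _ m≡n _ = m≡n
... | tri> _ _ n<m = contradiction n<m (χ-order≮ B A (sym ∘ eq))

χ-trace : ∀ {n} (A B : SquareMatrix n) → (∀ x → χ A x ≡ χ B x) → trace A ≡ trace B
χ-trace {zero}  A B eq = trans ∑-empty (sym ∑-empty)
χ-trace {suc n} A B eq with f , p , A≡ ← χ-expansion A | g , q , B≡ ← χ-expansion B =
  sym (ℤ.i-j≡0⇒i≡j _ _ (poly-leading (trace B - trace A) (poly-- p q) (always λ x → begin
    (trace B - trace A) * x ℤ.^ n + (f x - g x)
      ≡⟨ solve 6 (λ b a y z f g → (b :- a) :* y :+ (f :- g) := (z :- a :* y :+ f) :- (z :- b :* y :+ g))
           refl (trace B) (trace A) (x ℤ.^ n) (x ℤ.^ suc n) (f x) (g x) ⟩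
    (x ℤ.^ suc n - trace A * x ℤ.^ n + f x) - (x ℤ.^ suc n - trace B * x ℤ.^ n + g x)
      ≡⟨ cong₂ _-_ (sym (A≡ x)) (sym (B≡ x)) ⟩
    χ A x - χ B x
      ≡⟨ cong (_- χ B x) (eq x) ⟩
    χ B x - χ B x
      ≡⟨ ℤ.+-inverseʳ (χ B x) ⟩
    0ℤ ∎)))
  where
  open ≡-Reasoning
  open +-*-Solver

χ-agree : ∀ {n} (A B : SquareMatrix n) → Unbounded (λ x → χ A x ≡ χ B x) → ∀ x → χ A x ≡ χ B x
χ-agree A B eqs x = ℤ.i-j≡0⇒i≡j _ _ (poly-vanishes (poly-- (χ-polynomial A) (χ-polynomial B))
  (λ N → let y , N<y , eq = eqs N in y , N<y , trans (cong (_- χ B y) eq) (ℤ.+-inverseʳ (χ B y))) x)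

-- Used with two values of c: q leads from A to B, and 0 leads from B to its square.
quadratic : ∀ {n} → ℤ → SquareMatrix n → SquareMatrix n
quadratic c A i j = (A · A) i j + c * A i j

χ-quadratic : ∀ {n} c (A : SquareMatrix n) r →
              χ (quadratic c A) (r * (r + c)) ≡ χ A r * (sign n * χ A (- (r + c)))
χ-quadratic {n} c A r = begin
  χ (quadratic c A) (r * (r + c))
    ≡⟨ det-cong factor ⟩
  Det ((λ i j → scalar n r i j - A i j) · (λ i j → scalar n (r + c) i j + A i j))
    ≡⟨ det-· _ _ ⟩
  χ A r * Det (λ i j → scalar n (r + c) i j + A i j)
    -- The second factor is the negative of the matrix whose determinant is `χ A` at -(r + c); this
    -- is the source of `sign n`.
    ≡⟨ cong (χ A r *_) (trans (det-cong negate) (det-neg _)) ⟩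
  χ A r * (sign n * χ A (- (r + c))) ∎
  where
  open ≡-Reasoning
  open +-*-Solver

  factor : ∀ i j → scalar n (r * (r + c)) i j - quadratic c A i j
                 ≡ ((λ i j → scalar n r i j - A i j) · (λ i j → scalar n (r + c) i j + A i j)) i j
  factor i j = sym (begin
    ∑ (λ l → (scalar n r i l - A i l) * (scalar n s l j + A l j))
      ≡⟨ ∑-cong (λ l → solve 4 (λ u a v b → (u :- a) :* (v :+ b)
             := u :* (v :+ b) :+ con -1ℤ :* (a :* v :+ a :* b))
           refl (scalar n r i l) (A i l) (scalar n s l j) (A l j)) ⟩
    ∑ (λ l → scalar n r i l * (scalar n s l j + A l j) + -1ℤ * (A i l * scalar n s l j + A i l * A l j))
      ≡⟨ ∑-+ _ _ ⟩
    ∑ (λ l → scalar n r i l * (scalar n s l j + A l j)) + ∑ (λ l → -1ℤ * (A i l * scalar n s l j + A i l * A l j))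
      ≡⟨ cong₂ _+_ (∑-scalarˡ r i _) (trans (∑-*ˡ -1ℤ _)
           (cong (-1ℤ *_) (trans (∑-+ _ _) (cong (_+ (A · A) i j) (∑-scalarʳ s (A i) j))))) ⟩
    r * (scalar n s i j + A i j) + -1ℤ * (A i j * s + (A · A) i j)
      ≡⟨ cong (λ e → r * (e + A i j) + -1ℤ * (A i j * s + (A · A) i j)) (scalar-* s i j) ⟩
    r * (identity n i j * s + A i j) + -1ℤ * (A i j * s + (A · A) i j)
      ≡⟨ solve 5 (λ e r c a q → r :* (e :* (r :+ c) :+ a) :+ con -1ℤ :* (a :* (r :+ c) :+ q)
             := e :* (r :* (r :+ c)) :- (q :+ c :* a))
           refl (identity n i j) r c (A i j) ((A · A) i j) ⟩
    identity n i j * (r * s) - quadratic c A i j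
      ≡⟨ cong (_- quadratic c A i j) (sym (scalar-* (r * s) i j)) ⟩
    scalar n (r * s) i j - quadratic c A i j ∎)
    where s = r + c

  negate : ∀ i j → scalar n (r + c) i j + A i j ≡ - (scalar n (- (r + c)) i j - A i j)
  negate i j = begin
    scalar n (r + c) i j + A i j                     ≡⟨ cong (_+ A i j) (scalar-* (r + c) i j) ⟩
    identity n i j * (r + c) + A i j
      ≡⟨ solve 3 (λ e s a → e :* s :+ a := :- (e :* (:- s) :- a)) refl (identity n i j) (r + c) (A i j) ⟩
    - (identity n i j * - (r + c) - A i j)           ≡⟨ cong (λ e → - (e - A i j)) (scalar-* (- (r + c)) i j) ⟨
    - (scalar n (- (r + c)) i j - A i j)             ∎

-- `χ-quadratic` reaches only the arguments r (r + c), but these are unbounded, so `χ-agree` extends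
-- the equality to every integer.
χ-quadratic-cong : ∀ {n} c (A B : SquareMatrix n) → (∀ x → χ A x ≡ χ B x) →
                   ∀ x → χ (quadratic c A) x ≡ χ (quadratic c B) x
-- Since r exceeds ∣c∣, the factor r + c is nonzero, so the absolute value of r (r + c) is at least
-- r and hence greater than N.
χ-quadratic-cong {n} c A B eq = χ-agree _ _ λ N → let r = ℤ.+ (suc N ℕ.+ ∣ c ∣) in
  r * (r + c) , large N , trans (χ-quadratic c A r)
    (trans (cong₂ (λ u v → u * (sign n * v)) (eq r) (eq (- (r + c)))) (sym (χ-quadratic c B r)))
  where
  large : ∀ N → N ℕ.< ∣ ℤ.+ (suc N ℕ.+ ∣ c ∣) * (ℤ.+ (suc N ℕ.+ ∣ c ∣) + c) ∣
  large N = ℕ.<-≤-trans (ℕ.m≤m+n (suc N) ∣ c ∣) (subst (r ℕ.≤_) (sym (ℤ.abs-* (ℤ.+ r) (ℤ.+ r + c)))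
    (ℕ.m≤m*n r ∣ ℤ.+ r + c ∣ {{ℕ.≢-nonZero nonzero}}))
    where
    r = suc N ℕ.+ ∣ c ∣
    nonzero : ∣ ℤ.+ r + c ∣ ≢ 0
    nonzero eq = ℕ.m+1+n≢n N (trans (ℕ.+-suc N _) (trans
      (cong ∣_∣ (ℤ.i-j≡0⇒i≡j (ℤ.+ r) (- c) (trans (cong (ℤ.+ r +_) (ℤ.neg-involutive c)) (ℤ.∣i∣≡0⇒i≡0 eq))))
      (ℤ.∣-i∣≡∣i∣ c)))

-- Adjacency matrices

∑-const : ∀ n c → ∑ {n} (λ _ → c) ≡ ℤ.+ n * c
∑-const zero    c = ∑-empty
∑-const (suc n) c = trans (∑-suc _) (trans (cong (c +_) (∑-const n c)) (sym (ℤ.suc-* (ℤ.+ n) c)))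

∑-nonneg : ∀ {n} {f : Fin n → ℤ} → (∀ i → 0ℤ ≤ f i) → 0ℤ ≤ ∑ f
∑-nonneg {zero}  h = ℤ.≤-reflexive (sym ∑-empty)
∑-nonneg {suc n} h = ℤ.≤-trans (ℤ.+-mono-≤ (h zero) (∑-nonneg (h ∘ suc))) (ℤ.≤-reflexive (sym (∑-suc _)))

nonneg-sum-zero : ∀ {x y} → 0ℤ ≤ x → 0ℤ ≤ y → x + y ≡ 0ℤ → x ≡ 0ℤ × y ≡ 0ℤ
nonneg-sum-zero {ℤ.+ zero}  {ℤ.+ n} _ _ eq = refl , trans (sym (ℤ.+-identityˡ _)) eq
nonneg-sum-zero {ℤ.+ suc m} {ℤ.+ n} _ _ ()

∑-nonneg-zero : ∀ {n} {f : Fin n → ℤ} → (∀ i → 0ℤ ≤ f i) → ∑ f ≡ 0ℤ → ∀ i → f i ≡ 0ℤ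
∑-nonneg-zero {suc n} {f} h eq i with nonneg-sum-zero (h zero) (∑-nonneg (h ∘ suc)) (trans (sym (∑-suc f)) eq)
∑-nonneg-zero {suc n} {f} h eq zero    | f₀≡0 , _    = f₀≡0
∑-nonneg-zero {suc n} {f} h eq (suc i) | _    , ∑≡0 = ∑-nonneg-zero (h ∘ suc) ∑≡0 i

square-nonneg : ∀ x → 0ℤ ≤ x * x
square-nonneg (ℤ.+ n)      = subst (0ℤ ≤_) (ℤ.pos-* n n) (ℤ.+≤+ ℕ.z≤n)
square-nonneg (ℤ.-[1+ n ]) = ℤ.+≤+ ℕ.z≤n

square-zero : ∀ x → x * x ≡ 0ℤ → x ≡ 0ℤ
square-zero x eq with ℤ.i*j≡0⇒i≡0∨j≡0 x eq
... | inj₁ x≡0 = x≡0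
... | inj₂ x≡0 = x≡0

∑-square-deviation : ∀ {n} (f : Fin n → ℤ) k →
  ∑ (λ i → (f i - k) * (f i - k)) ≡ ∑ (λ i → f i * f i) + (- (ℤ.+ 2 * k) * ∑ f + ℤ.+ n * (k * k))
∑-square-deviation {n} f k = begin
  ∑ (λ i → (f i - k) * (f i - k))
    ≡⟨ ∑-cong (λ i → solve 2 (λ x k → (x :- k) :* (x :- k) := x :* x :+ (:- (con (ℤ.+ 2) :* k) :* x :+ k :* k))
         refl (f i) k) ⟩
  ∑ (λ i → f i * f i + (- (ℤ.+ 2 * k) * f i + k * k))
    ≡⟨ trans (∑-+ _ _) (cong (∑ (λ i → f i * f i) +_) (∑-linear (- (ℤ.+ 2 * k)) f _)) ⟩
  ∑ (λ i → f i * f i) + (- (ℤ.+ 2 * k) * ∑ f + ∑ {n} (λ _ → k * k))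
    ≡⟨ cong (λ e → ∑ (λ i → f i * f i) + (- (ℤ.+ 2 * k) * ∑ f + e)) (∑-const n (k * k)) ⟩
  ∑ (λ i → f i * f i) + (- (ℤ.+ 2 * k) * ∑ f + ℤ.+ n * (k * k)) ∎
  where
  open ≡-Reasoning
  open +-*-Solver

record IsAdjacency {n} (A : SquareMatrix n) : Set where
  field
    0∨1       : ∀ i j → A i j ≡ 0ℤ ⊎ A i j ≡ 1ℤ
    symmetric : ∀ i j → A i j ≡ A j i
    diagonal  : ∀ i → A i i ≡ 0ℤ

  idempotent : ∀ i j → A i j * A i j ≡ A i j
  idempotent i j with A i j | 0∨1 i j
  ... | _ | inj₁ refl = refl
  ... | _ | inj₂ refl = refl

  degree : Fin n → ℤ
  degree i = ∑ (A i)

  square-diagonal : ∀ i → (A · A) i i ≡ degree i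
  square-diagonal i = ∑-cong λ l → trans (cong (A i l *_) (symmetric l i)) (idempotent i l)

  quadratic-diagonal : ∀ q i → quadratic q A i i ≡ degree i
  quadratic-diagonal q i = trans (cong₂ (λ u v → u + q * v) (square-diagonal i) (diagonal i))
    (trans (cong (degree i +_) (ℤ.*-zeroʳ q)) (ℤ.+-identityʳ _))

  quadratic-symmetric : ∀ q i j → quadratic q A i j ≡ quadratic q A j i
  quadratic-symmetric q i j = cong₂ (λ u v → u + q * v)
    (∑-cong λ l → trans (ℤ.*-comm (A i l) (A l j)) (cong₂ _*_ (symmetric l j) (symmetric i l)))
    (symmetric i j)

  -- Both sides count the walks of length two, the right one by their middle vertex.
  ∑∑-square : ∑ (λ i → ∑ ((A · A) i)) ≡ ∑ (λ l → degree l * degree l)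
  ∑∑-square = begin
    ∑ (λ i → ∑ (λ j → ∑ (λ l → A i l * A l j)))  ≡⟨ ∑-cong (λ i → ∑-swap _) ⟩
    ∑ (λ i → ∑ (λ l → ∑ (λ j → A i l * A l j)))  ≡⟨ ∑-cong (λ i → ∑-cong λ l → ∑-*ˡ (A i l) (A l)) ⟩
    ∑ (λ i → ∑ (λ l → A i l * degree l))         ≡⟨ ∑-swap _ ⟩
    ∑ (λ l → ∑ (λ i → A i l * degree l))         ≡⟨ ∑-cong (λ l → ∑-*ʳ (degree l) (λ i → A i l)) ⟩
    ∑ (λ l → ∑ (λ i → A i l) * degree l)
      ≡⟨ ∑-cong (λ l → cong (_* degree l) (∑-cong λ i → symmetric i l)) ⟩
    ∑ (λ l → degree l * degree l)                ∎
    where open ≡-Reasoning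

  quadratic-constant : ∀ q k → 0ℤ ≤ k → ℤ.+ n ≡ k + q →
    trace (quadratic q A) ≡ ℤ.+ n * k →
    trace (quadratic q A · quadratic q A) ≡ ℤ.+ n * (ℤ.+ n * (k * k)) →
    ∀ i j → quadratic q A i j ≡ k
  quadratic-constant q k 0≤k n≡k+q tr-B tr-B² i j = ℤ.i-j≡0⇒i≡j _ _ (square-zero _
    (∑-nonneg-zero (λ j → square-nonneg (B i j - k))
      (∑-nonneg-zero (λ i → ∑-nonneg λ j → square-nonneg (B i j - k)) dev≡0 i) j))
    where
    open ≡-Reasoning
    open +-*-Solver
    B = quadratic q A
    N = ℤ.+ n
    Q = ∑ λ i → degree i * degree i
    dev  = ∑ λ i → ∑ λ j → (B i j - k) * (B i j - k)
    dev′ = ∑ λ i → (degree i - k) * (degree i - k)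

    ∑degree : ∑ degree ≡ N * k
    ∑degree = trans (∑-cong λ i → sym (quadratic-diagonal q i)) tr-B

    ∑∑B : ∑ (λ i → ∑ (B i)) ≡ Q + q * (N * k)
    ∑∑B = begin
      ∑ (λ i → ∑ (λ j → (A · A) i j + q * A i j))
        ≡⟨ ∑-cong (λ i → trans (∑-+ _ _) (cong (∑ ((A · A) i) +_) (∑-*ˡ q (A i)))) ⟩
      ∑ (λ i → ∑ ((A · A) i) + q * degree i)
        ≡⟨ trans (∑-+ _ _) (cong₂ _+_ ∑∑-square (∑-*ˡ q degree)) ⟩
      Q + q * ∑ degree                                      ≡⟨ cong (λ e → Q + q * e) ∑degree ⟩
      Q + q * (N * k)                                       ∎

    -- By symmetry of B the trace of its square is the sum of its squared entries.
    ∑∑B² : ∑ (λ i → ∑ (λ j → B i j * B i j)) ≡ N * (N * (k * k))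
    ∑∑B² = trans (∑-cong λ i → ∑-cong λ j → cong (B i j *_) (quadratic-symmetric q i j)) tr-B²

    dev-eq : dev ≡ N * (N * (k * k)) + (- (ℤ.+ 2 * k) * (Q + q * (N * k)) + N * (N * (k * k)))
    dev-eq = begin
      dev
        ≡⟨ ∑-cong (λ i → ∑-square-deviation (B i) k) ⟩
      ∑ (λ i → ∑ (λ j → B i j * B i j) + (- (ℤ.+ 2 * k) * ∑ (B i) + N * (k * k)))
        ≡⟨ trans (∑-+ _ _) (cong (∑ (λ i → ∑ (λ j → B i j * B i j)) +_) (∑-linear (- (ℤ.+ 2 * k)) _ _)) ⟩
      ∑ (λ i → ∑ (λ j → B i j * B i j)) + (- (ℤ.+ 2 * k) * ∑ (λ i → ∑ (B i)) + ∑ {n} (λ _ → N * (k * k)))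
        ≡⟨ cong₂ _+_ ∑∑B² (cong₂ (λ u v → - (ℤ.+ 2 * k) * u + v) ∑∑B (∑-const n _)) ⟩
      N * (N * (k * k)) + (- (ℤ.+ 2 * k) * (Q + q * (N * k)) + N * (N * (k * k))) ∎

    -- `Q` has coefficient -2 k in `dev` and 1 in `dev′`, which fixes the weight 2 k. The remainder
    -- contains the factor N - (k + q).
    total : dev + ℤ.+ 2 * k * dev′ ≡ 0ℤ
    total = begin
      dev + ℤ.+ 2 * k * dev′
        ≡⟨ cong₂ (λ u v → u + ℤ.+ 2 * k * v) dev-eq
             (trans (∑-square-deviation degree k) (cong (λ e → Q + (- (ℤ.+ 2 * k) * e + N * (k * k))) ∑degree)) ⟩
      N * (N * (k * k)) + (- (ℤ.+ 2 * k) * (Q + q * (N * k)) + N * (N * (k * k)))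
        + ℤ.+ 2 * k * (Q + (- (ℤ.+ 2 * k) * (N * k) + N * (k * k)))
        ≡⟨ solve 4 (λ N k q Q →
             N :* (N :* (k :* k)) :+ (:- (con (ℤ.+ 2) :* k) :* (Q :+ q :* (N :* k)) :+ N :* (N :* (k :* k)))
               :+ con (ℤ.+ 2) :* k :* (Q :+ (:- (con (ℤ.+ 2) :* k) :* (N :* k) :+ N :* (k :* k)))
             := con (ℤ.+ 2) :* N :* k :* k :* (N :- (k :+ q))) refl N k q Q ⟩
      ℤ.+ 2 * N * k * k * (N - (k + q))
        ≡⟨ cong (ℤ.+ 2 * N * k * k *_) (ℤ.i≡j⇒i-j≡0 n≡k+q) ⟩
      ℤ.+ 2 * N * k * k * 0ℤ
        ≡⟨ ℤ.*-zeroʳ (ℤ.+ 2 * N * k * k) ⟩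
      0ℤ ∎

    0≤2k*dev′ : 0ℤ ≤ ℤ.+ 2 * k * dev′
    0≤2k*dev′ = subst (0ℤ ≤_) (sym (trans (ℤ.*-assoc (ℤ.+ 2) k dev′) (solve 1 (λ x → con (ℤ.+ 2) :* x := x :+ x)
         refl (k * dev′)))) (ℤ.+-mono-≤ 0≤k*dev′ 0≤k*dev′)
      where
      0≤k*dev′ : 0ℤ ≤ k * dev′
      0≤k*dev′ = subst (_≤ k * dev′) (ℤ.*-zeroʳ k)
        (ℤ.*-monoˡ-≤-nonNeg k {{ℤ.nonNegative 0≤k}} (∑-nonneg λ i → square-nonneg (degree i - k)))

    dev≡0 : dev ≡ 0ℤ
    dev≡0 = proj₁ (nonneg-sum-zero (∑-nonneg λ i → ∑-nonneg λ j → square-nonneg (B i j - k)) 0≤2k*dev′ total)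

  -- By symmetry and the zero diagonal, twins says that non-adjacency is an equivalence relation.
  record Uniform (q : ℤ) : Set where
    field
      twins     : ∀ {i j l} → A i j ≡ 0ℤ → A i l ≡ A j l
      classSize : ∀ i → ∑ (λ j → 1ℤ - A i j) ≡ q

  ∑-nonadjacent : ∀ i → ∑ (λ j → 1ℤ - A i j) ≡ ℤ.+ n - degree i
  ∑-nonadjacent i = begin
    ∑ (λ j → 1ℤ - A i j)
      ≡⟨ ∑-cong (λ j → solve 1 (λ a → con 1ℤ :- a := con -1ℤ :* a :+ con 1ℤ) refl (A i j)) ⟩
    ∑ (λ j → -1ℤ * A i j + 1ℤ)         ≡⟨ ∑-linear -1ℤ (A i) _ ⟩
    -1ℤ * degree i + ∑ {n} (λ _ → 1ℤ)  ≡⟨ cong (-1ℤ * degree i +_) (∑-const n 1ℤ) ⟩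
    -1ℤ * degree i + ℤ.+ n * 1ℤ
      ≡⟨ solve 2 (λ d n → con -1ℤ :* d :+ n :* con 1ℤ := n :- d) refl (degree i) (ℤ.+ n) ⟩
    ℤ.+ n - degree i                   ∎
    where
    open ≡-Reasoning
    open +-*-Solver

  uniform⇒degree : ∀ {q} → Uniform q → ∀ i → degree i ≡ ℤ.+ n - q
  uniform⇒degree {q} u i = begin
    degree i                               ≡⟨ solve 2 (λ d n → d := n :- (n :- d)) refl (degree i) (ℤ.+ n) ⟩
    ℤ.+ n - (ℤ.+ n - degree i)
      ≡⟨ cong (λ e → ℤ.+ n - e) (trans (sym (∑-nonadjacent i)) (Uniform.classSize u i)) ⟩
    ℤ.+ n - q                              ∎
    where
    open ≡-Reasoning
    open +-*-Solver

  -- Twins share all their neighbours, so a non-adjacent pair has `degree i` common ones. For an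
  -- adjacent pair the class of i lies inside the neighbourhood of j, which leaves `degree j` - q
  -- common neighbours, and the term q A i j restores the missing q.
  uniform⇒quadratic : ∀ {q} → Uniform q → ∀ i j → quadratic q A i j ≡ ℤ.+ n - q
  uniform⇒quadratic {q} u i j with 0∨1 i j
  ... | inj₁ Aij≡0 = begin
    (A · A) i j + q * A i j
      ≡⟨ cong₂ (λ x y → x + q * y)
           (∑-cong λ l → trans (cong (A i l *_) (trans (symmetric l j) (sym (Uniform.twins u Aij≡0)))) (idempotent i l))
           Aij≡0 ⟩
    degree i + q * 0ℤ        ≡⟨ cong₂ _+_ (uniform⇒degree u i) (ℤ.*-zeroʳ q) ⟩
    ℤ.+ n - q + 0ℤ           ≡⟨ ℤ.+-identityʳ _ ⟩
    ℤ.+ n - q                ∎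
    where open ≡-Reasoning
  ... | inj₂ Aij≡1 = begin
    (A · A) i j + q * A i j                     ≡⟨ cong₂ (λ x y → x + q * y) (∑-cong term) Aij≡1 ⟩
    ∑ (λ l → -1ℤ * (1ℤ - A i l) + A j l) + q * 1ℤ ≡⟨ cong (_+ q * 1ℤ) (∑-linear -1ℤ _ _) ⟩
    -1ℤ * ∑ (λ l → 1ℤ - A i l) + degree j + q * 1ℤ
      ≡⟨ cong₂ (λ x y → -1ℤ * x + y + q * 1ℤ) (Uniform.classSize u i) (uniform⇒degree u j) ⟩
    -1ℤ * q + (ℤ.+ n - q) + q * 1ℤ
      ≡⟨ solve 2 (λ q n → con -1ℤ :* q :+ (n :- q) :+ q :* con 1ℤ := n :- q) refl q (ℤ.+ n) ⟩
    ℤ.+ n - q                                   ∎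
    where
    open ≡-Reasoning
    open +-*-Solver
    term : ∀ l → A i l * A l j ≡ -1ℤ * (1ℤ - A i l) + A j l
    term l with 0∨1 i l
    -- Here l is in the class of i, hence adjacent to j just as i is.
    ... | inj₁ Ail≡0 rewrite Ail≡0 | symmetric j l | sym (Uniform.twins u {l = j} Ail≡0) | Aij≡1 = refl
    ... | inj₂ Ail≡1 rewrite Ail≡1 | symmetric l j = solve 1 (λ a → con 1ℤ :* a
           := con -1ℤ :* (con 1ℤ :- con 1ℤ) :+ a)
         refl (A j l)

  -- The diagonal entries determine the degrees and with them the class sizes; the entries at
  -- non-adjacent pairs force equal neighbourhoods.
  quadratic⇒uniform : ∀ {q} → (∀ i j → quadratic q A i j ≡ ℤ.+ n - q) → Uniform q
  quadratic⇒uniform {q} B≡ = record { twins = twins ; classSize = classSize }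
    where
    open ≡-Reasoning
    open +-*-Solver
    degree≡ : ∀ i → degree i ≡ ℤ.+ n - q
    degree≡ i = trans (sym (quadratic-diagonal q i)) (B≡ i i)

    classSize : ∀ i → ∑ (λ j → 1ℤ - A i j) ≡ q
    classSize i = begin
      ∑ (λ j → 1ℤ - A i j)        ≡⟨ ∑-nonadjacent i ⟩
      ℤ.+ n - degree i            ≡⟨ cong (λ e → ℤ.+ n - e) (degree≡ i) ⟩
      ℤ.+ n - (ℤ.+ n - q)         ≡⟨ solve 2 (λ n q → n :- (n :- q) := q) refl (ℤ.+ n) q ⟩
      q                           ∎

    -- Non-adjacent i and j have as many common neighbours as i has neighbours.
    common : ∀ {i j} → A i j ≡ 0ℤ → ∀ l → A i l * A l j ≡ A i l
    -- Equal totals give equality term by term, because A i l A l j never exceeds A i l.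
    common {i} {j} Aij≡0 l = sym (ℤ.i-j≡0⇒i≡j _ _ (∑-nonneg-zero nonneg (begin
      ∑ (λ l → A i l - A i l * A l j)
        ≡⟨ ∑-cong (λ l → solve 2 (λ a b → a :- b := con -1ℤ :* b :+ a) refl (A i l) (A i l * A l j)) ⟩
      ∑ (λ l → -1ℤ * (A i l * A l j) + A i l)   ≡⟨ ∑-linear -1ℤ _ _ ⟩
      -1ℤ * (A · A) i j + degree i              ≡⟨ cong₂ (λ x y → -1ℤ * x + y) square≡ (degree≡ i) ⟩
      -1ℤ * (ℤ.+ n - q) + (ℤ.+ n - q)
        ≡⟨ solve 1 (λ x → con -1ℤ :* x :+ x := con 0ℤ) refl (ℤ.+ n - q) ⟩
      0ℤ                                        ∎) l))
      where
      square≡ : (A · A) i j ≡ ℤ.+ n - q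
      square≡ = trans (sym (trans (cong (λ e → (A · A) i j + q * e) Aij≡0)
        (trans (cong ((A · A) i j +_) (ℤ.*-zeroʳ q)) (ℤ.+-identityʳ _)))) (B≡ i j)
      nonneg : ∀ l → 0ℤ ≤ A i l - A i l * A l j
      nonneg l with A i l | A l j | 0∨1 i l | 0∨1 l j
      ... | _ | _ | inj₁ refl | _ = ℤ.+≤+ ℕ.z≤n
      ... | _ | _ | inj₂ refl | inj₁ refl = ℤ.+≤+ ℕ.z≤n
      ... | _ | _ | inj₂ refl | inj₂ refl = ℤ.+≤+ ℕ.z≤n

    neighbours⊆ : ∀ {i j l} → A i j ≡ 0ℤ → A i l ≡ 1ℤ → A j l ≡ 1ℤ
    neighbours⊆ {i} {j} {l} Aij≡0 Ail≡1 = begin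
      A j l           ≡⟨ symmetric j l ⟩
      A l j           ≡⟨ ℤ.*-identityˡ _ ⟨
      1ℤ * A l j      ≡⟨ cong (_* A l j) Ail≡1 ⟨
      A i l * A l j   ≡⟨ common Aij≡0 l ⟩
      A i l           ≡⟨ Ail≡1 ⟩
      1ℤ              ∎

    twins : ∀ {i j l} → A i j ≡ 0ℤ → A i l ≡ A j l
    twins {i} {j} {l} Aij≡0 with 0∨1 i l | 0∨1 j l
    ... | inj₁ p | inj₁ q = trans p (sym q)
    ... | inj₂ p | _      = trans p (sym (neighbours⊆ Aij≡0 p))
    ... | inj₁ _ | inj₂ q = trans (neighbours⊆ (trans (symmetric j i) Aij≡0) q) (sym q)

uniform-cospectral : ∀ {m n} {A : SquareMatrix m} {B : SquareMatrix n}
  (isA : IsAdjacency A) (isB : IsAdjacency B) →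
  (∀ x → χ A x ≡ χ B x) → ∀ {q} → q ≤ ℤ.+ n → IsAdjacency.Uniform isB q → m ≡ n × IsAdjacency.Uniform isA q
uniform-cospectral {m} {n} {A} {B} isA isB eq {q} q≤n u with refl ← χ-order A B eq =
  refl , quadratic⇒uniform isA
  -- The bound q ≤ n makes the weight 2 k of the second sum of squares nonnegative.
  (quadratic-constant isA q k (ℤ.i≤j⇒0≤j-i q≤n) (solve 2 (λ n q → n := n :- q :+ q) refl (ℤ.+ n) q)
    (begin
      trace (quadratic q A)  ≡⟨ χ-trace _ _ eqB ⟩
      trace (quadratic q B)  ≡⟨ ∑-cong (λ i → uniform⇒quadratic isB u i i) ⟩
      ∑ {n} (λ _ → k)        ≡⟨ ∑-const _ k ⟩
      ℤ.+ n * k              ∎)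
    (begin
      trace (quadratic q A · quadratic q A)  ≡⟨ trace-square (quadratic q A) ⟨
      trace (quadratic 0ℤ (quadratic q A))   ≡⟨ χ-trace _ _ (χ-quadratic-cong 0ℤ _ _ eqB) ⟩
      trace (quadratic 0ℤ (quadratic q B))   ≡⟨ trace-square (quadratic q B) ⟩
      trace (quadratic q B · quadratic q B)
        ≡⟨ ∑-cong (λ i → ∑-cong λ l → cong₂ _*_ (uniform⇒quadratic isB u i l) (uniform⇒quadratic isB u l i)) ⟩
      ∑ {n} (λ _ → ∑ {n} (λ _ → k * k))      ≡⟨ trans (∑-cong λ _ → ∑-const _ (k * k)) (∑-const _ _) ⟩
      ℤ.+ n * (ℤ.+ n * (k * k))              ∎))
  where
  open IsAdjacency
  open ≡-Reasoning
  open +-*-Solver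
  k = ℤ.+ n - q
  eqB = χ-quadratic-cong q A B eq
  trace-square : ∀ {n} (X : SquareMatrix n) → trace (quadratic 0ℤ X) ≡ trace (X · X)
  trace-square X = ∑-cong λ i → ℤ.+-identityʳ _

-- From real to integer characteristic polynomials

open Defs using (ℝ; _≈_; diff→0; fromℚ; 0ℝ; 1ℝ; _*ℝ_; ≗⇒≈; ℝ-commutativeRing; adjacencyMatrix)

-- Written directly in lowest terms with denominator 1, so that the numerator returns z by
-- computation; `ι-injective` rests on this.
fromℤ : ℤ → ℚ
fromℤ z = mkℚ z 0 (Coprimality.sym (Coprimality.1-coprimeTo ℤ.∣ z ∣))

fromℤ-+ : ∀ x y → fromℤ (x ℤ.+ y) ≡ fromℤ x ℚ.+ fromℤ y
fromℤ-+ x y = ℚ.toℚᵘ-injective (ℚᵘ.≃-trans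
  (ℚᵘ.*≡* (cong (ℤ._* 1ℤ) (cong₂ ℤ._+_ (sym (ℤ.*-identityʳ x)) (sym (ℤ.*-identityʳ y)))))
  (ℚᵘ.≃-sym (ℚ.toℚᵘ-homo-+ (fromℤ x) (fromℤ y))))

fromℤ-* : ∀ x y → fromℤ (x ℤ.* y) ≡ fromℤ x ℚ.* fromℤ y
fromℤ-* x y = ℚ.toℚᵘ-injective (ℚᵘ.≃-trans (ℚᵘ.*≡* refl) (ℚᵘ.≃-sym (ℚ.toℚᵘ-homo-* (fromℤ x) (fromℤ y))))

fromℤ-neg : ∀ x → fromℤ (ℤ.- x) ≡ ℚ.- fromℤ x
fromℤ-neg x = ℚ.toℚᵘ-injective (ℚᵘ.≃-trans (ℚᵘ.*≡* refl) (ℚᵘ.≃-sym (ℚ.toℚᵘ-homo‿- (fromℤ x))))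

-- Equality of rationals is decidable, and if a and b differed, convergence with ε = ∣a - b∣ would
-- give ∣a - b∣ < ∣a - b∣, the sequences being constant.
fromℚ-injective : ∀ {a b} → fromℚ a ≈ fromℚ b → a ≡ b
fromℚ-injective {a} {b} a≈b with a ℚ.≟ b
... | yes a≡b = a≡b
... | no a≢b  = contradiction (proj₂ (diff→0 a≈b ℚ.∣ a ℚ.- b ∣ positive) _ ℕ.≤-refl) (ℚ.<-irrefl refl)
  where
  positive : 0ℚ ℚ.< ℚ.∣ a ℚ.- b ∣
  positive = ℚ.≰⇒> λ ∣a-b∣≤0 → a≢b (Algebra.Properties.Group.x∙y⁻¹≈ε⇒x≈y ℚ.+-0-group a b
    (ℚ.∣p∣≡0⇒p≡0 (a ℚ.- b) (ℚ.≤-antisym ∣a-b∣≤0 (ℚ.0≤∣p∣ (a ℚ.- b)))))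

ι : ℤ → ℝ
ι = fromℚ ∘ fromℤ

ι-injective : ∀ {x y} → ι x ≈ ι y → x ≡ y
ι-injective = cong ℚ.↥_ ∘ fromℚ-injective

private
  module ℝR = CommutativeRing ℝ-commutativeRing
  module ℝD = Determinants ℝ-commutativeRing

ι-homo : RingMorphisms.IsRingHomomorphism (CommutativeRing.rawRing ℤ.+-*-commutativeRing) ℝR.rawRing ι
ι-homo = record
  { isSemiringHomomorphism = record
    { isNearSemiringHomomorphism = record
      { +-isMonoidHomomorphism = record
        { isMagmaHomomorphism = record
          { isRelHomomorphism = record { cong = ℝR.reflexive ∘ cong ι }
          ; homo = λ x y → ≗⇒≈ λ _ → fromℤ-+ x y
          }
        ; ε-homo = ≗⇒≈ λ _ → refl
        }
      ; *-homo = λ x y → ≗⇒≈ λ _ → fromℤ-* x y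
      }
    ; 1#-homo = ≗⇒≈ λ _ → refl
    }
  ; -‿homo = λ x → ≗⇒≈ λ _ → fromℤ-neg x
  }

adjacency : (G : Graph) → SquareMatrix (Graph.order G)
adjacency G i j = if does (adj? (vertex i) (vertex j)) then 1ℤ else 0ℤ
  where
  open Graph G
  vertex = Inverse.to enumeration

-- Here and below the arguments of trans and sym are given because inferring them unfolds the Cauchy proofs.
charPoly-ι : ∀ {n} (A : SquareMatrix n) (B : Defs.SquareMatrix n) → (∀ i j → B i j ≈ ι (A i j)) →
             ∀ x → Defs.charPoly B (ι x) ≈ ι (charPoly A x)
charPoly-ι A B B≈A x =
  ℝR.trans {Defs.charPoly B (ι x)} {Defs.charPoly (λ i j → ι (A i j)) (ι x)} {ι (charPoly A x)}
  (ℝD.charPoly-cong {A = B} {λ i j → ι (A i j)} B≈A (ι x))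
  (ℝR.sym {ι (charPoly A x)} {Defs.charPoly (λ i j → ι (A i j)) (ι x)}
    (charPoly-homo ℤ.+-*-commutativeRing ℝ-commutativeRing ι-homo A x))

adjacencyMatrix-ι : ∀ G i j → adjacencyMatrix G i j ≈ ι (adjacency G i j)
adjacencyMatrix-ι G i j = entry _
  where
  entry : ∀ b → (if b then 1ℝ else 0ℝ) ≈ ι (if b then 1ℤ else 0ℤ)
  entry true  = ≗⇒≈ λ _ → refl
  entry false = ≗⇒≈ λ _ → refl

∏ : (ℝ → ℝ) → List ℝ → ℝ
∏ f Λ = foldr _*ℝ_ 1ℝ (map f Λ)

spectrum-ι : ∀ {G Λ} → HasSpectrum G Λ → ∀ x → ι (charPoly (adjacency G) x) ≈ ∏ (λ μ → ι x ℝR.- μ) Λ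
spectrum-ι {G} {Λ} h x =
  ℝR.trans {ι (charPoly (adjacency G) x)} {Defs.charPoly (adjacencyMatrix G) (ι x)} {∏ (λ μ → ι x ℝR.- μ) Λ}
  (ℝR.sym {Defs.charPoly (adjacencyMatrix G) (ι x)} {ι (charPoly (adjacency G) x)}
    (charPoly-ι (adjacency G) (adjacencyMatrix G) (adjacencyMatrix-ι G) x))
  (h (ι x))

-- At an integer both real characteristic polynomials are images under `ι` of integers, and they
-- equal the same product up to the order of its factors.
cospectral⇒χ : ∀ {G H} → Cospectral G H → ∀ x → χ (adjacency G) x ≡ χ (adjacency H) x
cospectral⇒χ {G} {H} (Λ , M , Λ-spectrum , M-spectrum , Λ↭M) x =
  trans (sym (charPoly≈Det (adjacency G) x)) (trans (ι-injective
    (ℝR.trans {ιG} {∏Λ} {ιH} (spectrum-ι {G} {Λ} Λ-spectrum x)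
      (ℝR.trans {∏Λ} {∏M} {ιH} (product-↭ ℝ-commutativeRing (ι x) Λ↭M)
        (ℝR.sym {ιH} {∏M} (spectrum-ι {H} {M} M-spectrum x)))))
    (charPoly≈Det (adjacency H) x))
  where
  ιG = ι (charPoly (adjacency G) x)
  ιH = ι (charPoly (adjacency H) x)
  ∏Λ = ∏ (λ μ → ι x ℝR.- μ) Λ
  ∏M = ∏ (λ μ → ι x ℝR.- μ) M

-- Graphs whose non-adjacency relation is an equivalence with equal classes

open import Data.List.Base using ([]; _∷_)
open import Data.List.Relation.Unary.AllPairs using (_∷_)

lookup-injective : ∀ {X : Set} {xs : List X} → Unique xs → ∀ i j → lookup xs i ≡ lookup xs j → i ≡ j
lookup-injective (_  ∷ _)    zero    zero    _  = refl
lookup-injective (x∉ ∷ _)    zero    (suc j) eq = contradiction eq (All.lookup x∉ (∈-lookup j))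
lookup-injective (x∉ ∷ _)    (suc i) zero    eq = contradiction (sym eq) (All.lookup x∉ (∈-lookup i))
lookup-injective (_  ∷ uniq) (suc i) (suc j) eq = cong suc (lookup-injective uniq i j eq)

module _ {X : Set} {P : X → Set} (P? : Unary.Decidable P) where

  length-filter-∁ : ∀ xs → length (filter P? xs) ℕ.+ length (filter (∁? P?) xs) ≡ length xs
  length-filter-∁ []       = refl
  length-filter-∁ (x ∷ xs) with does (P? x)
  ... | true  = cong suc (length-filter-∁ xs)
  ... | false = trans (ℕ.+-suc _ _) (cong suc (length-filter-∁ xs))

  filter-⊆ : ∀ {Q : X → Set} (Q? : Unary.Decidable Q) → (∀ {x} → P x → Q x) →
             ∀ xs → filter P? (filter Q? xs) ≡ filter P? xs
  filter-⊆ Q? P⇒Q []       = refl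
  filter-⊆ Q? P⇒Q (x ∷ xs) with Q? x
  ... | no ¬Qx = trans (filter-⊆ Q? P⇒Q xs) (sym (List.filter-reject P? (¬Qx ∘ P⇒Q)))
  ... | yes _ with does (P? x)
  ...   | true  = cong (x ∷_) (filter-⊆ Q? P⇒Q xs)
  ...   | false = filter-⊆ Q? P⇒Q xs

module _ {X : Set} {_~_ : X → X → Set} (_~?_ : Decidable _~_)
         (~-sym : Symmetric _~_) (~-trans : Transitive _~_)
         (q : ℕ) .{{_ : NonZero q}} where

  -- Peel off the class of the first element of xs.
  arrange-classes : ∀ p xs → Unique xs → length xs ≡ p ℕ.* q →
    (∀ {x} → x ∈ xs → length (filter (x ~?_) xs) ≡ q) →
    Σ[ f ∈ (Fin p → Fin q → X) ]
      (∀ a b → f a b ∈ xs) ×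
      (∀ a b a′ b′ → (f a b ~ f a′ b′) ⇔ (a ≡ a′)) ×
      (∀ a b b′ → f a b ≡ f a b′ → b ≡ b′)
  arrange-classes zero xs _ _ _ = (λ ()) , (λ ()) , (λ ()) , (λ ())
  arrange-classes (suc p) [] _ eq _ = contradiction (ℕ.m+n≡0⇒m≡0 q (sym eq)) (ℕ.≢-nonZero⁻¹ q)
  arrange-classes (suc p) xs@(x ∷ _) uniq len sizes = f , f∈ , f~ , f-inj
    where
    class = filter (x ~?_) xs
    rest  = filter (∁? (x ~?_)) xs
    class-size : length class ≡ q
    class-size = sizes (here refl)

    ih = arrange-classes p rest (Unique.filter⁺ (∁? (x ~?_)) uniq)
      (ℕ.+-cancelˡ-≡ q _ _ (trans (cong (ℕ._+ length rest) (sym class-size))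
        (trans (length-filter-∁ (x ~?_) xs) len)))
      -- Nothing related to y is related to x, so removing the class of x leaves the class of y
      -- whole.
      (λ {y} y∈ → let y∈xs , x≁y = ∈-filter⁻ (∁? (x ~?_)) {xs = xs} y∈ in
        trans (cong length (filter-⊆ (y ~?_) (∁? (x ~?_)) (λ y~z x~z → x≁y (~-trans x~z (~-sym y~z))) xs))
              (sizes y∈xs))

    g  = proj₁ ih
    g∈ : ∀ a b → g a b ∈ xs × ¬ (x ~ g a b)
    g∈ a b = ∈-filter⁻ (∁? (x ~?_)) {xs = xs} (proj₁ (proj₂ ih) a b)

    h : Fin q → X
    h b = lookup class (Fin.cast (sym class-size) b)
    h∈ : ∀ b → h b ∈ xs × (x ~ h b)
    h∈ b = ∈-filter⁻ (x ~?_) {xs = xs} (∈-lookup (Fin.cast (sym class-size) b))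

    f : Fin (suc p) → Fin q → X
    f zero    = h
    f (suc a) = g a

    f∈ : ∀ a b → f a b ∈ xs
    f∈ zero    b = proj₁ (h∈ b)
    f∈ (suc a) b = proj₁ (g∈ a b)

    f~ : ∀ a b a′ b′ → (f a b ~ f a′ b′) ⇔ (a ≡ a′)
    f~ zero    b zero     b′ = mk⇔ (λ _ → refl) (λ _ → ~-trans (~-sym (proj₂ (h∈ b))) (proj₂ (h∈ b′)))
    f~ zero    b (suc a′) b′ = mk⇔ (λ h~g → contradiction (~-trans (proj₂ (h∈ b)) h~g) (proj₂ (g∈ a′ b′))) (λ ())
    f~ (suc a) b zero     b′ =
      mk⇔ (λ g~h → contradiction (~-trans (proj₂ (h∈ b′)) (~-sym g~h)) (proj₂ (g∈ a b))) (λ ())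
    f~ (suc a) b (suc a′) b′ = let e = proj₁ (proj₂ (proj₂ ih)) a b a′ b′ in
      mk⇔ (cong suc ∘ Equivalence.to e) (Equivalence.from e ∘ Fin.suc-injective)

    f-inj : ∀ a b b′ → f a b ≡ f a b′ → b ≡ b′
    f-inj zero    b b′ eq = Fin.toℕ-injective (trans (sym (Fin.toℕ-cast (sym class-size) b))
      (trans (cong toℕ (lookup-injective (Unique.filter⁺ (x ~?_) uniq) _ _ eq))
        (Fin.toℕ-cast (sym class-size) b′)))
    f-inj (suc a) b b′ eq = proj₂ (proj₂ (proj₂ ih)) a b b′ eq

-- Injections between finite sets of equal size, and labellings by class and position

injective⇒surjective : ∀ {n} {f : Fin n → Fin n} → (∀ {i j} → f i ≡ f j → i ≡ j) → ∀ y → ∃[ x ] f x ≡ y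
injective⇒surjective {suc n} {f} inj y with Fin.any? (λ x → f x Fin.≟ y)
... | yes found = found
-- A missed value can be punched out of the codomain, leaving an injection into a set with one
-- element less.
... | no missed = contradiction
  (Fin.injective⇒≤ {f = λ x → punchOut (y≢f x)} (λ {i} {j} eq → inj (Fin.punchOut-injective (y≢f i) (y≢f j) eq)))
  ℕ.1+n≰n
  where
  y≢f : ∀ x → y ≢ f x
  y≢f x y≡fx = missed (x , sym y≡fx)

injective-×⇒surjective : ∀ {p q n} → n ≡ p ℕ.* q → (f : Fin p × Fin q → Fin n) →
                         (∀ {u v} → f u ≡ f v → u ≡ v) → ∀ y → ∃[ u ] f u ≡ y
injective-×⇒surjective {p} {q} refl f inj y =
  let x , eq = injective⇒surjective {f = f ∘ remQuot {p} q} (λ {x} {y} eq →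
        trans (sym (Fin.combine-remQuot {p} q x))
          (trans (cong (uncurry combine) (inj eq)) (Fin.combine-remQuot {p} q y))) y
  in remQuot {p} q x , eq

injective⇒↔ : ∀ {p q n} → n ≡ p ℕ.* q → (f : Fin p × Fin q → Fin n) → (∀ {u v} → f u ≡ f v → u ≡ v) →
              (Fin p × Fin q) ↔ Fin n
injective⇒↔ n≡pq f inj = mk↔ₛ′ f (proj₁ ∘ preimage) (proj₂ ∘ preimage) (λ u → inj (proj₂ (preimage (f u))))
  where
  preimage = injective-×⇒surjective n≡pq f inj

-- Converts the class size of `Uniform`, a sum of matrix entries, into the filtered length that
-- `arrange-classes` expects.
∑-indicator : ∀ {X : Set} {a : X → ℤ} → (∀ x → a x ≡ 0ℤ ⊎ a x ≡ 1ℤ) → ∀ {n} (f : Fin n → X) →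
  ∑ (λ j → 1ℤ - a (f j)) ≡ ℤ.+ length (filter (λ x → a x ℤ.≟ 0ℤ) (tabulate f))
∑-indicator         0∨1 {zero}  f = ∑-empty
∑-indicator {a = a} 0∨1 {suc n} f with 0∨1 (f zero)
... | inj₁ a≡0 rewrite dec-true (a (f zero) ℤ.≟ 0ℤ) a≡0 =
  trans (∑-suc _) (cong₂ _+_ (cong (λ e → 1ℤ - e) a≡0) (∑-indicator 0∨1 (f ∘ suc)))
... | inj₂ a≡1 rewrite dec-false (a (f zero) ℤ.≟ 0ℤ) (λ a≡0 → contradiction (trans (sym a≡1) a≡0) λ ()) =
  trans (∑-suc _) (trans (cong₂ _+_ (cong (λ e → 1ℤ - e) a≡1) (∑-indicator 0∨1 (f ∘ suc))) (ℤ.+-identityˡ _))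

module _ {n} {A : SquareMatrix n} (isA : IsAdjacency A) {q} .{{_ : NonZero q}}
         (u : IsAdjacency.Uniform isA (ℤ.+ q)) where
  open IsAdjacency isA

  uniform⇒labelling : ∀ p → n ≡ p ℕ.* q →
    Σ[ b ∈ ((Fin p × Fin q) ↔ Fin n) ] (∀ v w → A (Inverse.to b v) (Inverse.to b w) ≡ 0ℤ ⇔ proj₁ v ≡ proj₁ w)
  uniform⇒labelling p n≡pq =
    let f , _ , f~ , f-inj = arrange-classes {_~_ = λ i j → A i j ≡ 0ℤ} (λ i j → A i j ℤ.≟ 0ℤ)
          (λ {i} {j} → trans (symmetric j i)) (λ Aij≡0 → trans (Uniform.twins u Aij≡0))
          q p (allFin n) (Unique.allFin⁺ n) (trans (List.length-tabulate id) n≡pq)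
          (λ {i} _ → ℤ.+-injective (trans (sym (∑-indicator (0∨1 i) id)) (Uniform.classSize u i)))
    in injective⇒↔ n≡pq (uncurry f) (λ {(a , b)} {(a′ , b′)} eq →
         inj f~ f-inj a b a′ b′ eq
           -- A vertex is not adjacent to itself, so equal vertices lie in the same class; `inj`
           -- then compares positions within it.
           (Equivalence.to (f~ a b a′ b′) (trans (cong (A (f a b)) (sym eq)) (diagonal _)))) ,
       λ (a , b) (a′ , b′) → f~ a b a′ b′
    where
    inj : ∀ {f : Fin p → Fin q → Fin n} →
          (∀ a b a′ b′ → (A (f a b) (f a′ b′) ≡ 0ℤ) ⇔ (a ≡ a′)) → (∀ a b b′ → f a b ≡ f a b′ → b ≡ b′) →
          ∀ a b a′ b′ → f a b ≡ f a′ b′ → a ≡ a′ → (a , b) ≡ (a′ , b′)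
    inj f~ f-inj a b .a b′ eq refl = cong (a ,_) (f-inj a b b′ eq)

module _ (G : Graph) where
  open Graph G
  private
    vertex = Inverse.to enumeration

  adjacency≡0 : ∀ {i j} → ¬ Adj (vertex i) (vertex j) → adjacency G i j ≡ 0ℤ
  adjacency≡0 {i} {j} ¬adj rewrite dec-false (adj? (vertex i) (vertex j)) ¬adj = refl

  adjacency≡1 : ∀ {i j} → Adj (vertex i) (vertex j) → adjacency G i j ≡ 1ℤ
  adjacency≡1 {i} {j} adj rewrite dec-true (adj? (vertex i) (vertex j)) adj = refl

  adj⇔ : ∀ i j → Adj (vertex i) (vertex j) ⇔ adjacency G i j ≢ 0ℤ
  adj⇔ i j with adj? (vertex i) (vertex j)
  ... | yes adj = mk⇔ (λ _ ()) (λ _ → adj)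
  ... | no ¬adj = mk⇔ (λ adj _ → ¬adj adj) (λ ≢0 → contradiction refl ≢0)

  adjacency-isAdjacency : IsAdjacency (adjacency G)
  adjacency-isAdjacency = record
    { 0∨1       = 0∨1
    ; symmetric = λ i j → cong (if_then 1ℤ else 0ℤ)
        (does-⇔ (mk⇔ adj-sym adj-sym) (adj? (vertex i) (vertex j)) (adj? (vertex j) (vertex i)))
    ; diagonal  = λ i → adjacency≡0 adj-irrefl
    }
    where
    0∨1 : ∀ i j → adjacency G i j ≡ 0ℤ ⊎ adjacency G i j ≡ 1ℤ
    0∨1 i j with does (adj? (vertex i) (vertex j))
    ... | true  = inj₂ refl
    ... | false = inj₁ refl

  graph-labelling : ∀ p q .{{_ : NonZero q}} → order ≡ p ℕ.* q →
    IsAdjacency.Uniform adjacency-isAdjacency (ℤ.+ q) →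
    Σ[ ℓ ∈ (Vertex ↔ (Fin p × Fin q)) ] (∀ x y → Adj x y ⇔ proj₁ (Inverse.to ℓ x) ≢ proj₁ (Inverse.to ℓ y))
  graph-labelling p q order≡ u = ℓ , adjℓ
    where
    labelling = uniform⇒labelling adjacency-isAdjacency u p order≡
    b = proj₁ labelling
    ℓ = ↔-trans (↔-sym enumeration) (↔-sym b)
    vertex-ℓ : ∀ x → vertex (Inverse.to b (Inverse.to ℓ x)) ≡ x
    vertex-ℓ x = trans (cong vertex (Inverse.strictlyInverseˡ b _)) (Inverse.strictlyInverseˡ enumeration x)
    adjℓ : ∀ x y → Adj x y ⇔ proj₁ (Inverse.to ℓ x) ≢ proj₁ (Inverse.to ℓ y)
    adjℓ x y = mk⇔
      (λ adj → Equivalence.to adj⇔ij (subst₂ Adj (sym (vertex-ℓ x)) (sym (vertex-ℓ y)) adj)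
             ∘ Equivalence.from same⇔)
      (λ ≢ → subst₂ Adj (vertex-ℓ x) (vertex-ℓ y) (Equivalence.from adj⇔ij (≢ ∘ Equivalence.to same⇔)))
      where
      same⇔ = proj₂ labelling (Inverse.to ℓ x) (Inverse.to ℓ y)
      adj⇔ij = adj⇔ (Inverse.to b (Inverse.to ℓ x)) (Inverse.to b (Inverse.to ℓ y))

uniform⇒≅ : ∀ {G H} p q .{{_ : NonZero q}} → Graph.order G ≡ p ℕ.* q → Graph.order H ≡ p ℕ.* q →
  IsAdjacency.Uniform (adjacency-isAdjacency G) (ℤ.+ q) →
  IsAdjacency.Uniform (adjacency-isAdjacency H) (ℤ.+ q) → G ≅ H
uniform⇒≅ {G} {H} p q G-order H-order uG uH = record
  { bijection = ↔-trans ℓ (↔-sym ℓ′)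
  ; preserves = λ x y → mk⇔
      (λ adj → Equivalence.from (adjℓ′ _ _) (subst₂ _≢_ (back x) (back y) (Equivalence.to (adjℓ x y) adj)))
      (λ adj → Equivalence.from (adjℓ x y)
        (subst₂ _≢_ (sym (back x)) (sym (back y)) (Equivalence.to (adjℓ′ _ _) adj)))
  }
  where
  G-labelling = graph-labelling G p q G-order uG
  H-labelling = graph-labelling H p q H-order uH
  ℓ  = proj₁ G-labelling
  ℓ′ = proj₁ H-labelling
  adjℓ  = proj₂ G-labelling
  adjℓ′ = proj₂ H-labelling
  back : ∀ x → proj₁ (Inverse.to ℓ x) ≡ proj₁ (Inverse.to ℓ′ (Inverse.from ℓ′ (Inverse.to ℓ x)))
  back x = cong proj₁ (sym (Inverse.strictlyInverseˡ ℓ′ (Inverse.to ℓ x)))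

-- The unitary Cayley graph of a prime power

%-≡⇒∣ : ∀ p .{{_ : NonZero p}} i c → (i ℕ.+ c) % p ≡ i % p → p ∣ c
%-≡⇒∣ p i c eq = ∣m+n∣m⇒∣n (m%n≡0⇒n∣m (t ℕ.+ i ℕ.+ c) p (begin
  (t ℕ.+ i ℕ.+ c) % p              ≡⟨ cong (_% p) (ℕ.+-assoc t i c) ⟩
  (t ℕ.+ (i ℕ.+ c)) % p            ≡⟨ %-distribˡ-+ t (i ℕ.+ c) p ⟩
  (t % p ℕ.+ (i ℕ.+ c) % p) % p    ≡⟨ cong (λ e → (t % p ℕ.+ e) % p) eq ⟩
  (t % p ℕ.+ i % p) % p            ≡⟨ %-distribˡ-+ t i p ⟨
  (t ℕ.+ i) % p                    ≡⟨ n∣m⇒m%n≡0 (t ℕ.+ i) p p∣t+i ⟩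
  0                                ∎)) p∣t+i
  where
  open ≡-Reasoning
  -- A representative of -i modulo p: adding it to both sides cancels i without subtraction.
  t = i ℕ.* ℕ.pred p
  p∣t+i : p ∣ t ℕ.+ i
  p∣t+i = divides i (trans (ℕ.+-comm t i) (trans (sym (ℕ.*-suc i (ℕ.pred p))) (cong (i ℕ.*_) (ℕ.suc-pred p))))

gcd-prime-power : ∀ {p m c} → Prime p → gcd c (p ^ suc m) ≡ 1 ⇔ (¬ p ∣ c)
gcd-prime-power {p} {m} {c} p-prime = mk⇔
  (λ gcd≡1 p∣c → contradiction (gcd≡1⇒coprime gcd≡1 (p∣c , m∣m*n (p ^ m)))
    (ℕ.nonTrivial⇒≢1 {{prime⇒nonTrivial p-prime}}))
  (λ p∤c → coprime⇒gcd≡1 (coprime p∤c (suc m)))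
  where
  coprime : ¬ p ∣ c → ∀ m → Coprime c (p ^ m)
  coprime p∤c zero    (_   , d∣1)  = ∣1⇒≡1 d∣1
  coprime p∤c (suc m) {d} (d∣c , d∣pᵐ) = coprime p∤c m (d∣c , coprime-divisor d⊥p d∣pᵐ)
    where
    d⊥p : Coprime d p
    d⊥p (e∣d , e∣p) with prime⇒irreducible p-prime e∣p
    ... | inj₁ e≡1  = e≡1
    ... | inj₂ refl = contradiction (∣-trans e∣d d∣c) p∤c

-- The group law i + (-i + j) = j of `ℤ/ n` survives reduction modulo a divisor of n. The additive
-- form avoids subtraction of residues.
difference-% : ∀ n .{{_ : NonZero n}} p .{{_ : NonZero p}} → p ∣ n → ∀ i j →
  (toℕ i ℕ.+ toℕ (Defs.addMod n (Defs.negMod n i) j)) % p ≡ toℕ j % p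
difference-% n p p∣n i j = begin
  (toℕ i ℕ.+ toℕ d) % p              ≡⟨ m∣n⇒o%n%m≡o%m p n _ p∣n ⟨
  (toℕ i ℕ.+ toℕ d) % n % p          ≡⟨ cong (_% p) (Fin.toℕ-fromℕ< (m%n<n (toℕ i ℕ.+ toℕ d) n)) ⟨
  toℕ (Defs.addMod n i d) % p
    ≡⟨ cong (λ x → toℕ x % p) (Algebra.Properties.Group.\\-leftDividesˡ (FiniteGroup.group (Defs.ℤ/ n)) i j) ⟩
  toℕ j % p                          ∎
  where
  open ≡-Reasoning
  d = Defs.addMod n (Defs.negMod n i) j

-- Counting the members of a residue class

∑-+ℕ : ∀ m n (f : ℕ → ℤ) → ∑ {m ℕ.+ n} (f ∘ toℕ) ≡ ∑ {m} (f ∘ toℕ) + ∑ {n} (λ j → f (m ℕ.+ toℕ j))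
∑-+ℕ zero    n f = sym (trans (cong (_+ ∑ {n} (f ∘ toℕ)) ∑-empty) (ℤ.+-identityˡ _))
∑-+ℕ (suc m) n f = begin
  ∑ {suc (m ℕ.+ n)} (f ∘ toℕ)
    ≡⟨ ∑-suc _ ⟩
  f 0 + ∑ {m ℕ.+ n} (f ∘ suc ∘ toℕ)
    ≡⟨ cong (f 0 +_) (∑-+ℕ m n (f ∘ suc)) ⟩
  f 0 + (∑ {m} (f ∘ suc ∘ toℕ) + ∑ {n} (λ j → f (suc (m ℕ.+ toℕ j))))
    ≡⟨ ℤ.+-assoc (f 0) _ _ ⟨
  f 0 + ∑ {m} (f ∘ suc ∘ toℕ) + ∑ {n} (λ j → f (suc (m ℕ.+ toℕ j)))
    ≡⟨ cong (_+ ∑ {n} (λ j → f (suc (m ℕ.+ toℕ j)))) (∑-suc _) ⟨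
  ∑ {suc m} (f ∘ toℕ) + ∑ {n} (λ j → f (suc (m ℕ.+ toℕ j))) ∎
  where open ≡-Reasoning

∑-periodic : ∀ p q (f : ℕ → ℤ) → (∀ x → f (p ℕ.+ x) ≡ f x) → ∑ {q ℕ.* p} (f ∘ toℕ) ≡ ℤ.+ q * ∑ {p} (f ∘ toℕ)
∑-periodic p zero    f periodic = ∑-empty
∑-periodic p (suc q) f periodic = begin
  ∑ {p ℕ.+ q ℕ.* p} (f ∘ toℕ)                                        ≡⟨ ∑-+ℕ p (q ℕ.* p) f ⟩
  ∑ {p} (f ∘ toℕ) + ∑ {q ℕ.* p} (λ j → f (p ℕ.+ toℕ j))
    ≡⟨ cong (∑ {p} (f ∘ toℕ) +_) (∑-cong λ j → periodic (toℕ j)) ⟩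
  ∑ {p} (f ∘ toℕ) + ∑ {q ℕ.* p} (f ∘ toℕ)
    ≡⟨ cong (∑ {p} (f ∘ toℕ) +_) (∑-periodic p q f periodic) ⟩
  ∑ {p} (f ∘ toℕ) + ℤ.+ q * ∑ {p} (f ∘ toℕ)                          ≡⟨ ℤ.suc-* (ℤ.+ q) _ ⟨
  ℤ.+ suc q * ∑ {p} (f ∘ toℕ)                                        ∎
  where open ≡-Reasoning

residue-count : ∀ p .{{_ : NonZero p}} q r → r ℕ.< p →
  ∑ {q ℕ.* p} (λ j → if does (r ℕ.≟ toℕ j % p) then 1ℤ else 0ℤ) ≡ ℤ.+ q
residue-count p q r r<p = begin
  ∑ {q ℕ.* p} (f ∘ toℕ)                         ≡⟨ ∑-periodic p q f periodic ⟩
  -- Within one period the indicator of the class of r is row `s` of the identity matrix, so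
  -- `∑-scalarˡ` evaluates its sum to 1.
  ℤ.+ q * ∑ {p} (f ∘ toℕ)                       ≡⟨ cong (ℤ.+ q *_) (∑-cong indicator) ⟩
  ℤ.+ q * ∑ {p} (λ j → scalar p 1ℤ s j * 1ℤ)    ≡⟨ cong (ℤ.+ q *_) (∑-scalarˡ 1ℤ s (λ _ → 1ℤ)) ⟩
  ℤ.+ q * 1ℤ                                    ≡⟨ ℤ.*-identityʳ (ℤ.+ q) ⟩
  ℤ.+ q                                         ∎
  where
  open ≡-Reasoning
  f : ℕ → ℤ
  f x = if does (r ℕ.≟ x % p) then 1ℤ else 0ℤ
  s = Fin.fromℕ< r<p
  periodic : ∀ x → f (p ℕ.+ x) ≡ f x
  periodic x = cong (λ y → if does (r ℕ.≟ y) then 1ℤ else 0ℤ)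
    (trans (cong (_% p) (ℕ.+-comm p x)) ([m+n]%n≡m%n x p))
  indicator : ∀ j → f (toℕ j) ≡ scalar p 1ℤ s j * 1ℤ
  indicator j = trans (cong (if_then 1ℤ else 0ℤ) (does-⇔ (mk⇔ to from) (r ℕ.≟ toℕ j % p) (s Fin.≟ j)))
    (sym (ℤ.*-identityʳ _))
    where
    to : r ≡ toℕ j % p → s ≡ j
    to eq = Fin.toℕ-injective (trans (Fin.toℕ-fromℕ< r<p) (trans eq (m<n⇒m%n≡m (Fin.toℕ<n j))))
    from : s ≡ j → r ≡ toℕ j % p
    from refl = trans (sym (Fin.toℕ-fromℕ< r<p)) (sym (m<n⇒m%n≡m (Fin.toℕ<n j)))

module _ {p} (p-prime : Prime p) (m : ℕ) (n>1 : NonTrivial (p ^ suc m)) where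
  private
    instance
      p≢0 : NonZero p
      p≢0 = prime⇒nonZero p-prime
      n≢0 : NonZero (p ^ suc m)
      n≢0 = ℕ.nonTrivial⇒nonZero (p ^ suc m) {{n>1}}
    Γ = unitaryCayleyGraph (p ^ suc m) n>1

  -- Coprimality to a power of p means not being divisible by p; applied to j - i, this identifies
  -- the parts of the graph with the residue classes modulo p.
  unitary-adj⇔ : ∀ i j → Graph.Adj Γ i j ⇔ toℕ i % p ≢ toℕ j % p
  unitary-adj⇔ i j = mk⇔
    (λ gcd≡1 i≡j → Equivalence.to coprime⇔ gcd≡1 (%-≡⇒∣ p (toℕ i) _ (trans diff (sym i≡j))))
    (λ i≢j → Equivalence.from coprime⇔ λ p∣c → i≢j (trans (sym (%-remove-+ʳ (toℕ i) p∣c)) diff))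
    where
    coprime⇔ = gcd-prime-power {m = m} {c = toℕ (Defs.addMod (p ^ suc m) (Defs.negMod (p ^ suc m) i) j)} p-prime
    diff = difference-% (p ^ suc m) p (m∣m*n (p ^ m)) i j

  unitary-adjacency : ∀ i j → adjacency Γ i j ≡ 1ℤ - (if does (toℕ i % p ℕ.≟ toℕ j % p) then 1ℤ else 0ℤ)
  unitary-adjacency i j = by (toℕ i % p ℕ.≟ toℕ j % p)
    where
    by : (d : Dec (toℕ i % p ≡ toℕ j % p)) → adjacency Γ i j ≡ 1ℤ - (if does d then 1ℤ else 0ℤ)
    by (yes i≡j) = adjacency≡0 Γ {i} {j} (λ adj → Equivalence.to (unitary-adj⇔ i j) adj i≡j)
    by (no i≢j)  = adjacency≡1 Γ {i} {j} (Equivalence.from (unitary-adj⇔ i j) i≢j)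

  unitary-uniform : IsAdjacency.Uniform (adjacency-isAdjacency Γ) (ℤ.+ (p ^ m))
  unitary-uniform = record
    { twins = λ {i} {j} {l} Aij≡0 → trans (unitary-adjacency i l) (trans
        (cong (λ r → 1ℤ - (if does (r ℕ.≟ toℕ l % p) then 1ℤ else 0ℤ)) (same i j Aij≡0))
        (sym (unitary-adjacency j l)))
    ; classSize = λ i → trans (∑-cong λ j → complement i j) (count (p ^ suc m) (ℕ.*-comm p (p ^ m)) (toℕ i))
    }
    where
    same : ∀ i j → adjacency Γ i j ≡ 0ℤ → toℕ i % p ≡ toℕ j % p
    same i j Aij≡0 with toℕ i % p ℕ.≟ toℕ j % p
    ... | yes i≡j = i≡j
    ... | no  i≢j = contradiction
      (trans (sym (adjacency≡1 Γ {i} {j} (Equivalence.from (unitary-adj⇔ i j) i≢j))) Aij≡0) λ ()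

    complement : ∀ i j → 1ℤ - adjacency Γ i j ≡ (if does (toℕ i % p ℕ.≟ toℕ j % p) then 1ℤ else 0ℤ)
    complement i j = trans (cong (λ e → 1ℤ - e) (unitary-adjacency i j))
      (solve 1 (λ e → con 1ℤ :- (con 1ℤ :- e) := e) refl (if does (toℕ i % p ℕ.≟ toℕ j % p) then 1ℤ else 0ℤ))
      where open +-*-Solver

    -- The order unfolds to p * p ^ m, whereas `residue-count` sums over p ^ m blocks of length p;
    -- with n a variable the commutativity equation can be matched by `refl`.
    count : ∀ n → n ≡ p ^ m ℕ.* p → ∀ i →
      ∑ {n} (λ j → if does (i % p ℕ.≟ toℕ j % p) then 1ℤ else 0ℤ) ≡ ℤ.+ (p ^ m)
    count _ refl i = residue-count p (p ^ m) (i % p) (m%n<n i p)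

-- Spectral determination of balanced complete multipartite graphs

uniform⇒DS : ∀ Γ p q .{{_ : NonZero p}} .{{_ : NonZero q}} → Graph.order Γ ≡ p ℕ.* q →
  IsAdjacency.Uniform (adjacency-isAdjacency Γ) (ℤ.+ q) → DS Γ
uniform⇒DS Γ p q order≡pq Γ-uniform H cospectral =
  let order≡ , H-uniform = uniform-cospectral (adjacency-isAdjacency H) (adjacency-isAdjacency Γ)
        (cospectral⇒χ {H} {Γ} cospectral)
        (ℤ.+≤+ (ℕ.≤-trans (ℕ.m≤n*m q p) (ℕ.≤-reflexive (sym order≡pq)))) Γ-uniform
  in uniform⇒≅ {H} {Γ} p q (trans order≡ order≡pq) order≡pq H-uniform Γ-uniform

theorem3p2 : (p m : ℕ) (p-prime : Prime p) (m≥1 : m ≥ 1) →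
    DS (unitaryCayleyGraph (p ^ m) (primePower-nonTrivial p-prime m≥1))
theorem3p2 p (suc m) p-prime m≥1 =
  uniform⇒DS (unitaryCayleyGraph (p ^ suc m) (primePower-nonTrivial p-prime m≥1)) p (p ^ m)
    {{prime⇒nonZero p-prime}} {{ℕ.m^n≢0 p m {{prime⇒nonZero p-prime}}}} refl
    (unitary-uniform p-prime m (primePower-nonTrivial p-prime m≥1))
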